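{- Let $\alpha,\beta\ge1$ be real numbers. As $X\to\infty$, $$\frac{\#\mathcal{E}(X;H_{\alpha,\beta})}{\#\widetilde{\mathcal{E}}(X;H_{\alpha,\beta})}=\frac{1}{\zeta(10)}+O(X^{ -1/3}).$$
   Context: For $(A,B)\in\mathbb{Z}^2$ let $E_{A,B}$ denote the curve $y^2=x^3+Ax+B$; curves are counted by their pairs $(A,B)$. Let $\widetilde{\mathcal{E}}$ be the set of all $E_{A,B}$ with $A,B\in\mathbb{Z}$ and $-16(4A^3+27B^2)\neq 0$. Let $\mathcal{E}$ be the set of $E_{A,B}\in\widetilde{\mathcal{E}}$ such that there is no prime $p$ with $p^4\mid A$ and $p^6\mid B$ (a complete set of representatives for the $\mathbb{Q}$-isomorphism classes of elliptic curves over $\mathbb{Q}$). For real $\alpha,\beta\ge1$, $H_{\alpha,\beta}(E_{A,B}):=\max\{\alpha|A|^3,\beta B^2\}$, and for a family $\mathcal{F}$ and $X>0$, $\mathcal{F}(X;H_{\alpha,\beta}):=\{E_{A,B}\in\mathcal{F}: H_{\alpha,\beta}(E_{A,B})\le X\}$. $\zeta$ is the Riemann zeta function. The parameters $\alpha,\beta$ are fixed; the implied constant may depend on them. -}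

module Defs where

open import Data.Nat.Base as ℕ using (ℕ; zero; suc)
import Data.Nat.Properties as ℕ
import Data.Nat.Primality as ℕ
open import Data.Nat.Tactic.RingSolver using (solve-∀)
open import Data.Integer.Base as ℤ using (ℤ; +_; 0ℤ; -[1+_])
import Data.Integer.Divisibility as ℤ
import Data.Integer.Properties as ℤ
open import Data.Rational.Base as ℚ using (ℚ; 0ℚ; 1ℚ; ½)
import Data.Rational.Properties as ℚ
import Data.Rational.Solver as ℚ-Solver
import Data.Rational.Unnormalised.Base as ℚᵘ
import Data.Rational.Unnormalised.Properties as ℚᵘ
open import Data.List.Base using (List; length)
open import Data.List.Membership.Propositional using (_∈_)
open import Data.List.Relation.Unary.Unique.Propositional using (Unique)
open import Data.Product.Base using (_×_; _,_; ∃-syntax)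
open import Data.Sum.Base using (inj₁; inj₂)
open import Function.Bundles using (_⇔_)
open import Level using (0ℓ)
open import Relation.Binary.PropositionalEquality
  using (_≡_; _≢_; refl; sym; trans; cong; cong₂; subst; subst₂)
open import Relation.Nullary.Negation.Core using (¬_)
open import Relation.Unary using (Pred)

private
  variable
    p q r s ε : ℚ

module ℚ-Facts where
  open import Data.Rational.Base using (_+_; _-_; -_; _*_; 1/_; _⊔_; ∣_∣; _≤_; _<_; NonNegative)
  open ℚ-Solver.+-*-Solver using (solve; _:+_; _:*_; :-_; _:-_; _:=_; con)
  open ℚ.≤-Reasoning

  p≤q+∣p-q∣ : ∀ p q → p ≤ q + ∣ p - q ∣
  p≤q+∣p-q∣ p q = begin
    p                 ≡⟨ solve 2 (λ p q → p := q :+ (p :- q)) refl p q ⟩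
    q + (p - q)       ≤⟨ ℚ.+-monoʳ-≤ q (p≤∣p∣ (p - q)) ⟩
    q + ∣ p - q ∣     ∎
    where
    p≤∣p∣ : ∀ p → p ≤ ∣ p ∣
    p≤∣p∣ p with ℚ.≤-total 0ℚ p
    ... | inj₁ 0≤p = ℚ.≤-reflexive (sym (ℚ.0≤p⇒∣p∣≡p 0≤p))
    ... | inj₂ p≤0 = ℚ.≤-trans p≤0 (ℚ.0≤∣p∣ p)

  ∣p-q∣-comm : ∀ p q → ∣ p - q ∣ ≡ ∣ q - p ∣
  ∣p-q∣-comm p q = trans (sym (ℚ.∣-p∣≡∣p∣ (p - q)))
    (cong ∣_∣ (solve 2 (λ p q → :- (p :- q) := q :- p) refl p q))

  ∣p-q∣≤r : p ≤ q + r → q ≤ p + r → ∣ p - q ∣ ≤ r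
  ∣p-q∣≤r {p} {q} {r} p≤q+r q≤p+r with ℚ.∣p∣≡p∨∣p∣≡-p (p - q)
  ... | inj₁ eq = begin
    ∣ p - q ∣         ≡⟨ eq ⟩
    p - q             ≤⟨ ℚ.+-monoˡ-≤ (- q) p≤q+r ⟩
    q + r - q         ≡⟨ solve 2 (λ q r → q :+ r :- q := r) refl q r ⟩
    r                 ∎
  ... | inj₂ eq = begin
    ∣ p - q ∣         ≡⟨ eq ⟩
    - (p - q)         ≡⟨ solve 2 (λ p q → :- (p :- q) := q :- p) refl p q ⟩
    q - p             ≤⟨ ℚ.+-monoˡ-≤ (- p) q≤p+r ⟩
    p + r - p         ≡⟨ solve 2 (λ q r → q :+ r :- q := r) refl p r ⟩
    r                 ∎

  ∣∣p∣-∣q∣∣≤∣p-q∣ : ∀ p q → ∣ ∣ p ∣ - ∣ q ∣ ∣ ≤ ∣ p - q ∣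
  ∣∣p∣-∣q∣∣≤∣p-q∣ p q =
    ∣p-q∣≤r (half p q) (subst (λ d → ∣ q ∣ ≤ ∣ p ∣ + d) (∣p-q∣-comm q p) (half q p))
    where
    half : ∀ p q → ∣ p ∣ ≤ ∣ q ∣ + ∣ p - q ∣
    half p q = begin
      ∣ p ∣               ≡⟨ cong ∣_∣ (solve 2 (λ p q → p := q :+ (p :- q)) refl p q) ⟩
      ∣ q + (p - q) ∣     ≤⟨ ℚ.∣p+q∣≤∣p∣+∣q∣ q (p - q) ⟩
      ∣ q ∣ + ∣ p - q ∣   ∎

  sub-lipschitz : ∀ p q r s → ∣ (p - q) - (r - s) ∣ ≤ ∣ p - r ∣ + ∣ q - s ∣
  sub-lipschitz p q r s = begin
    ∣ (p - q) - (r - s) ∣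
      ≡⟨ cong ∣_∣ (solve 4 (λ p q r s → (p :- q) :- (r :- s) := (p :- r) :- (q :- s)) refl p q r s) ⟩
    ∣ (p - r) - (q - s) ∣   ≤⟨ ℚ.∣p-q∣≤∣p∣+∣q∣ (p - r) (q - s) ⟩
    ∣ p - r ∣ + ∣ q - s ∣   ∎

  ⊔-lipschitz : ∀ p q r s → ∣ (p ⊔ q) - (r ⊔ s) ∣ ≤ ∣ p - r ∣ + ∣ q - s ∣
  ⊔-lipschitz p q r s = ∣p-q∣≤r (half p q r s)
    (subst₂ (λ d e → r ⊔ s ≤ (p ⊔ q) + (d + e)) (∣p-q∣-comm r p) (∣p-q∣-comm s q) (half r s p q))
    where
    half : ∀ p q r s → p ⊔ q ≤ (r ⊔ s) + (∣ p - r ∣ + ∣ q - s ∣)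
    half p q r s = ℚ.⊔-lub
      (begin
        p                                  ≤⟨ p≤q+∣p-q∣ p r ⟩
        r + ∣ p - r ∣                      ≡⟨ cong (_+_ r) (ℚ.+-identityʳ _) ⟨
        r + (∣ p - r ∣ + 0ℚ)
          ≤⟨ ℚ.+-mono-≤ (ℚ.p≤p⊔q r s) (ℚ.+-monoʳ-≤ ∣ p - r ∣ (ℚ.0≤∣p∣ (q - s))) ⟩
        (r ⊔ s) + (∣ p - r ∣ + ∣ q - s ∣)  ∎)
      (begin
        q                                  ≤⟨ p≤q+∣p-q∣ q s ⟩
        s + ∣ q - s ∣                      ≡⟨ cong (_+_ s) (ℚ.+-identityˡ _) ⟨
        s + (0ℚ + ∣ q - s ∣)
          ≤⟨ ℚ.+-mono-≤ (ℚ.p≤q⊔p r s) (ℚ.+-monoˡ-≤ ∣ q - s ∣ (ℚ.0≤∣p∣ (p - r))) ⟩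
        (r ⊔ s) + (∣ p - r ∣ + ∣ q - s ∣)  ∎)

  ∣p⊔r-q⊔r∣≤∣p-q∣ : ∀ p q r → ∣ (p ⊔ r) - (q ⊔ r) ∣ ≤ ∣ p - q ∣
  ∣p⊔r-q⊔r∣≤∣p-q∣ p q r = begin
    ∣ (p ⊔ r) - (q ⊔ r) ∣   ≤⟨ ⊔-lipschitz p r q r ⟩
    ∣ p - q ∣ + ∣ r - r ∣   ≡⟨ cong (λ d → ∣ p - q ∣ + ∣ d ∣) (ℚ.+-inverseʳ r) ⟩
    ∣ p - q ∣ + 0ℚ          ≡⟨ ℚ.+-identityʳ _ ⟩
    ∣ p - q ∣               ∎

  *-lipschitz : ∀ p q r s → ∣ p * q - r * s ∣ ≤ ∣ p ∣ * ∣ q - s ∣ + ∣ s ∣ * ∣ p - r ∣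
  *-lipschitz p q r s = begin
    ∣ p * q - r * s ∣
      ≡⟨ cong ∣_∣ (solve 4 (λ p q r s → p :* q :- r :* s := p :* (q :- s) :+ s :* (p :- r)) refl p q r s) ⟩
    ∣ p * (q - s) + s * (p - r) ∣           ≤⟨ ℚ.∣p+q∣≤∣p∣+∣q∣ (p * (q - s)) (s * (p - r)) ⟩
    ∣ p * (q - s) ∣ + ∣ s * (p - r) ∣       ≡⟨ cong₂ _+_ (ℚ.∣p*q∣≡∣p∣*∣q∣ p (q - s)) (ℚ.∣p*q∣≡∣p∣*∣q∣ s (p - r)) ⟩
    ∣ p ∣ * ∣ q - s ∣ + ∣ s ∣ * ∣ p - r ∣   ∎

  0<½ : 0ℚ < ½
  0<½ = ℚ.positive⁻¹ ½

  *-pos : 0ℚ < p → 0ℚ < q → 0ℚ < p * q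
  *-pos {p} {q} 0<p 0<q =
    ℚ.positive⁻¹ (p * q) {{ℚ.pos*pos⇒pos p {{ℚ.positive 0<p}} q {{ℚ.positive 0<q}}}}

  +-pos : 0ℚ < p → 0ℚ < q → 0ℚ < p + q
  +-pos = ℚ.+-mono-<

  half+half : ∀ p → p * ½ + p * ½ ≡ p
  half+half p = trans (sym (ℚ.*-distribˡ-+ p ½ ½)) (ℚ.*-identityʳ p)

  *-mono : 0ℚ ≤ q → 0ℚ ≤ r → p ≤ r → q ≤ s → p * q ≤ r * s
  *-mono {q} {r} {p} {s} 0≤q 0≤r p≤r q≤s = ℚ.≤-trans
    (ℚ.*-monoʳ-≤-nonNeg q {{ℚ.nonNegative 0≤q}} p≤r)
    (ℚ.*-monoˡ-≤-nonNeg r {{ℚ.nonNegative 0≤r}} q≤s)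

  recip : ∀ p → 0ℚ < p → ℚ
  recip p 0<p = (1/ p) {{ℚ.pos⇒nonZero p {{ℚ.positive 0<p}}}}

  recip-pos : ∀ p (0<p : 0ℚ < p) → 0ℚ < recip p 0<p
  recip-pos p 0<p = ℚ.positive⁻¹ (recip p 0<p) {{ℚ.1/pos⇒pos p {{ℚ.positive 0<p}}}}

  *-recip : ∀ p (0<p : 0ℚ < p) → p * recip p 0<p ≡ 1ℚ
  *-recip p 0<p = ℚ.*-inverseʳ p {{ℚ.pos⇒nonZero p {{ℚ.positive 0<p}}}}

  recip-antimono : ∀ p q (0<p : 0ℚ < p) (0<q : 0ℚ < q) → p ≤ q → recip q 0<q ≤ recip p 0<p
  recip-antimono p q 0<p 0<q p≤q = begin
    q′               ≡⟨ ℚ.*-identityˡ q′ ⟨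
    1ℚ * q′          ≡⟨ cong (_* q′) (*-recip p 0<p) ⟨
    p * p′ * q′      ≤⟨ ℚ.*-monoʳ-≤-nonNeg q′ {{nn q′ (recip-pos q 0<q)}}
                          (ℚ.*-monoʳ-≤-nonNeg p′ {{nn p′ (recip-pos p 0<p)}} p≤q) ⟩
    q * p′ * q′      ≡⟨ solve 3 (λ q p′ q′ → q :* p′ :* q′ := p′ :* (q :* q′)) refl q p′ q′ ⟩
    p′ * (q * q′)    ≡⟨ cong (_*_ p′) (*-recip q 0<q) ⟩
    p′ * 1ℚ          ≡⟨ ℚ.*-identityʳ p′ ⟩
    p′               ∎
    where
    p′ = recip p 0<p
    q′ = recip q 0<q
    nn : ∀ x → 0ℚ < x → NonNegative x
    nn x 0<x = ℚ.nonNegative (ℚ.<⇒≤ 0<x)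

  recip-lipschitz : ∀ p q c (0<p : 0ℚ < p) (0<q : 0ℚ < q) (0<c : 0ℚ < c) → c ≤ p → c ≤ q →
                    ∣ recip p 0<p - recip q 0<q ∣ ≤ (recip c 0<c * recip c 0<c) * ∣ p - q ∣
  recip-lipschitz p q c 0<p 0<q 0<c c≤p c≤q = begin
    ∣ p′ - q′ ∣
      ≡⟨ cong ∣_∣ (cong₂ (λ a b → a - b)
           (trans (sym (ℚ.*-identityʳ p′)) (cong (_*_ p′) (sym (*-recip q 0<q))))
           (trans (sym (ℚ.*-identityʳ q′)) (cong (_*_ q′) (sym (*-recip p 0<p))))) ⟩
    ∣ p′ * (q * q′) - q′ * (p * p′) ∣
      ≡⟨ cong ∣_∣ (solve 4 (λ p q p′ q′ → p′ :* (q :* q′) :- q′ :* (p :* p′) := (p′ :* q′) :* (q :- p)) refl p q p′ q′) ⟩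
    ∣ (p′ * q′) * (q - p) ∣
      ≡⟨ ℚ.∣p*q∣≡∣p∣*∣q∣ (p′ * q′) (q - p) ⟩
    ∣ p′ * q′ ∣ * ∣ q - p ∣
      ≡⟨ cong₂ _*_ (ℚ.0≤p⇒∣p∣≡p (ℚ.<⇒≤ (*-pos (recip-pos p 0<p) (recip-pos q 0<q)))) (∣p-q∣-comm q p) ⟩
    (p′ * q′) * ∣ p - q ∣
      ≤⟨ ℚ.*-monoʳ-≤-nonNeg ∣ p - q ∣ {{ℚ.nonNegative (ℚ.0≤∣p∣ (p - q))}}
           (*-mono (ℚ.<⇒≤ (recip-pos q 0<q)) (ℚ.<⇒≤ (recip-pos c 0<c))
                   (recip-antimono c p 0<c 0<p c≤p) (recip-antimono c q 0<c 0<q c≤q)) ⟩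
    (c′ * c′) * ∣ p - q ∣ ∎
    where
    p′ = recip p 0<p
    q′ = recip q 0<q
    c′ = recip c 0<c

  *-estimate : ∀ p q r s K L ε (0<K : 0ℚ < K) (0<L : 0ℚ < L) (0<K+L : 0ℚ < K + L) →
               ∣ p ∣ ≤ K → ∣ s ∣ ≤ L →
               ∣ p - r ∣ ≤ ε * recip (K + L) 0<K+L →
               ∣ q - s ∣ ≤ ε * recip (K + L) 0<K+L →
               ∣ p * q - r * s ∣ ≤ ε
  *-estimate p q r s K L ε 0<K 0<L 0<K+L ∣p∣≤K ∣s∣≤L p-r q-s = begin
    ∣ p * q - r * s ∣
      ≤⟨ *-lipschitz p q r s ⟩
    ∣ p ∣ * ∣ q - s ∣ + ∣ s ∣ * ∣ p - r ∣
      ≤⟨ ℚ.+-mono-≤ (*-mono (ℚ.0≤∣p∣ (q - s)) (ℚ.<⇒≤ 0<K) ∣p∣≤K q-s)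
                    (*-mono (ℚ.0≤∣p∣ (p - r)) (ℚ.<⇒≤ 0<L) ∣s∣≤L p-r) ⟩
    K * (ε * t) + L * (ε * t)
      ≡⟨ solve 4 (λ K L ε t → K :* (ε :* t) :+ L :* (ε :* t) := (K :+ L) :* t :* ε) refl K L ε t ⟩
    (K + L) * t * ε
      ≡⟨ cong (_* ε) (*-recip (K + L) 0<K+L) ⟩
    1ℚ * ε
      ≡⟨ ℚ.*-identityˡ ε ⟩
    ε ∎
    where t = recip (K + L) 0<K+L

  recip-estimate : ∀ p q c ε (0<p : 0ℚ < p) (0<q : 0ℚ < q) (0<c : 0ℚ < c) → c ≤ p → c ≤ q →
                   ∣ p - q ∣ ≤ ε * (c * c) → ∣ recip p 0<p - recip q 0<q ∣ ≤ ε
  recip-estimate p q c ε 0<p 0<q 0<c c≤p c≤q p-q = begin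
    ∣ recip p 0<p - recip q 0<q ∣
      ≤⟨ recip-lipschitz p q c 0<p 0<q 0<c c≤p c≤q ⟩
    c′ * c′ * ∣ p - q ∣
      ≤⟨ ℚ.*-monoˡ-≤-nonNeg (c′ * c′) {{ℚ.nonNegative (ℚ.<⇒≤ (*-pos 0<c′ 0<c′))}} p-q ⟩
    c′ * c′ * (ε * (c * c))
      ≡⟨ solve 3 (λ c′ ε c → c′ :* c′ :* (ε :* (c :* c)) := (c :* c′) :* (c :* c′) :* ε) refl c′ ε c ⟩
    (c * c′) * (c * c′) * ε
      ≡⟨ cong (λ u → u * u * ε) (*-recip c 0<c) ⟩
    1ℚ * 1ℚ * ε
      ≡⟨ ℚ.*-identityˡ ε ⟩
    ε ∎
    where
    c′ = recip c 0<c
    0<c′ = recip-pos c 0<c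

  1/ℕ : (n : ℕ) .{{_ : ℕ.NonZero n}} → ℚ
  1/ℕ n = + 1 ℚ./ n

  0<1/ℕ : ∀ n .{{_ : ℕ.NonZero n}} → 0ℚ < 1/ℕ n
  0<1/ℕ n = ℚ.positive⁻¹ (1/ℕ n) {{ℚ.normalize-pos 1 n}}

  1/ℕ-antimono : ∀ m n .{{_ : ℕ.NonZero m}} .{{_ : ℕ.NonZero n}} → m ℕ.≤ n → 1/ℕ n ≤ 1/ℕ m
  1/ℕ-antimono m@(suc _) n@(suc _) m≤n = ℚ.toℚᵘ-cancel-≤
    (ℚᵘ.≤-respʳ-≃ (ℚᵘ.≃-sym (ℚ.toℚᵘ-fromℚᵘ (+ 1 ℚᵘ./ m)))
      (ℚᵘ.≤-respˡ-≃ (ℚᵘ.≃-sym (ℚ.toℚᵘ-fromℚᵘ (+ 1 ℚᵘ./ n)))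
        (ℚᵘ.*≤* (ℤ.*-monoˡ-≤-nonNeg (+ 1) (ℤ.+≤+ m≤n)))))

  1/ℕ-archimedean : 0ℚ < ε → 1/ℕ (ℚ.↧ₙ ε) ≤ ε
  1/ℕ-archimedean {ε@(ℚ.mkℚ (+ suc a) b-1 _)} 0<ε = ℚ.toℚᵘ-cancel-≤
    (ℚᵘ.≤-respˡ-≃ (ℚᵘ.≃-sym (ℚ.toℚᵘ-fromℚᵘ (+ 1 ℚᵘ./ suc b-1)))
      (ℚᵘ.*≤* (ℤ.*-monoʳ-≤-nonNeg (+ suc b-1) (ℤ.+≤+ (ℕ.s≤s (ℕ.z≤n {a}))))))
  1/ℕ-archimedean {ℚ.mkℚ (+ zero) _ _} (ℚ.*<* (ℤ.+<+ ()))
  1/ℕ-archimedean {ℚ.mkℚ -[1+ _ ] _ _} (ℚ.*<* ())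

  1/ℕ-telescope : ∀ n → let instance _ = ℕ.m*n≢0 (suc n) (suc (suc n)) in
                  1/ℕ (suc n ℕ.* suc (suc n)) + 1/ℕ (suc (suc n)) ≡ 1/ℕ (suc n)
  1/ℕ-telescope n = ℚ.toℚᵘ-injective
    (ℚᵘ.≃-trans (ℚ.toℚᵘ-homo-+ (1/ℕ (suc n ℕ.* suc (suc n))) (1/ℕ (suc (suc n))))
      (ℚᵘ.≃-trans (ℚᵘ.+-cong (ℚ.toℚᵘ-fromℚᵘ (+ 1 ℚᵘ./ (suc n ℕ.* suc (suc n))))
                              (ℚ.toℚᵘ-fromℚᵘ (+ 1 ℚᵘ./ suc (suc n))))
        (ℚᵘ.≃-trans (ℚᵘ.*≡* (cong +_ (identity n)))
          (ℚᵘ.≃-sym (ℚ.toℚᵘ-fromℚᵘ (+ 1 ℚᵘ./ suc n))))))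
    where
    identity : ∀ n → (1 ℕ.* suc (suc n) ℕ.+ 1 ℕ.* (suc n ℕ.* suc (suc n))) ℕ.* suc n
                   ≡ 1 ℕ.* ((suc n ℕ.* suc (suc n)) ℕ.* suc (suc n))
    identity = solve-∀

open ℚ-Facts

-- A real number is a Cauchy sequence of rationals; equality of reals is _≈_.
record ℝ : Set where
  constructor mkℝ
  field
    seq    : ℕ → ℚ
    cauchy : ∀ ε → 0ℚ ℚ.< ε →
             ∃[ N ] ∀ m n → N ℕ.≤ m → N ℕ.≤ n → ℚ.∣ seq m ℚ.- seq n ∣ ℚ.≤ ε

open ℝ public

infix  4 _≈_ _≤_ _<_
infixl 6 _-_ _⊔_
infixl 7 _*_
infixr 8 _^_

_≈_ : ℝ → ℝ → Set
x ≈ y = ∀ ε → 0ℚ ℚ.< ε → ∃[ N ] ∀ n → N ℕ.≤ n → ℚ.∣ seq x n ℚ.- seq y n ∣ ℚ.≤ ε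

_≤_ : ℝ → ℝ → Set
x ≤ y = ∀ ε → 0ℚ ℚ.< ε → ∃[ N ] ∀ n → N ℕ.≤ n → seq x n ℚ.≤ seq y n ℚ.+ ε

_<_ : ℝ → ℝ → Set
x < y = ∃[ ε ] 0ℚ ℚ.< ε × ∃[ N ] ∀ n → N ℕ.≤ n → seq x n ℚ.+ ε ℚ.≤ seq y n

fromℚ : ℚ → ℝ
fromℚ p .seq    _     = p
fromℚ p .cauchy ε 0<ε = 0 , λ _ _ _ _ →
  ℚ.≤-trans (ℚ.≤-reflexive (cong ℚ.∣_∣ (ℚ.+-inverseʳ p))) (ℚ.<⇒≤ 0<ε)

fromℤ : ℤ → ℝ
fromℤ i = fromℚ (i ℚ./ 1)

0ℝ 1ℝ : ℝ
0ℝ = fromℚ 0ℚ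
1ℝ = fromℚ 1ℚ

lift₂ : (f : ℚ → ℚ → ℚ) →
        (∀ p q r s → ℚ.∣ f p q ℚ.- f r s ∣ ℚ.≤ ℚ.∣ p ℚ.- r ∣ ℚ.+ ℚ.∣ q ℚ.- s ∣) →
        ℝ → ℝ → ℝ
lift₂ f lip x y .seq n = f (seq x n) (seq y n)
lift₂ f lip x y .cauchy ε 0<ε =
  let M , hx = cauchy x (ε ℚ.* ½) (*-pos 0<ε 0<½)
      N , hy = cauchy y (ε ℚ.* ½) (*-pos 0<ε 0<½)
  in M ℕ.⊔ N , λ m n le le′ →
    ℚ.≤-trans (lip (seq x m) (seq y m) (seq x n) (seq y n))
      (ℚ.≤-trans
        (ℚ.+-mono-≤ (hx m n (ℕ.m⊔n≤o⇒m≤o M N le) (ℕ.m⊔n≤o⇒m≤o M N le′))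
                    (hy m n (ℕ.m⊔n≤o⇒n≤o M N le) (ℕ.m⊔n≤o⇒n≤o M N le′)))
        (ℚ.≤-reflexive (half+half ε)))

_-_ : ℝ → ℝ → ℝ
_-_ = lift₂ ℚ._-_ sub-lipschitz

_⊔_ : ℝ → ℝ → ℝ
_⊔_ = lift₂ ℚ._⊔_ ⊔-lipschitz

∣_∣ : ℝ → ℝ
∣ x ∣ .seq n = ℚ.∣ seq x n ∣
∣ x ∣ .cauchy ε 0<ε =
  let N , h = cauchy x ε 0<ε
  in N , λ m n le le′ → ℚ.≤-trans (∣∣p∣-∣q∣∣≤∣p-q∣ (seq x m) (seq x n)) (h m n le le′)

bounded : ∀ x → ∃[ K ] 0ℚ ℚ.< K × ∃[ N ] ∀ n → N ℕ.≤ n → ℚ.∣ seq x n ∣ ℚ.≤ K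
bounded x =
  let N , h = cauchy x 1ℚ (ℚ.positive⁻¹ 1ℚ) in
  1ℚ ℚ.+ ℚ.∣ seq x N ∣ ,
  ℚ.+-mono-<-≤ (ℚ.positive⁻¹ 1ℚ) (ℚ.0≤∣p∣ (seq x N)) ,
  N , λ n N≤n → ℚ.≤-trans (p≤q+∣p-q∣ ℚ.∣ seq x n ∣ ℚ.∣ seq x N ∣)
    (ℚ.≤-trans (ℚ.+-monoʳ-≤ ℚ.∣ seq x N ∣
                 (ℚ.≤-trans (∣∣p∣-∣q∣∣≤∣p-q∣ (seq x n) (seq x N)) (h n N N≤n ℕ.≤-refl)))
               (ℚ.≤-reflexive (ℚ.+-comm ℚ.∣ seq x N ∣ 1ℚ)))

_*_ : ℝ → ℝ → ℝ
(x * y) .seq n = seq x n ℚ.* seq y n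
(x * y) .cauchy ε 0<ε =
  let K , 0<K , Nx , hx = bounded x
      L , 0<L , Ny , hy = bounded y
      0<K+L  = +-pos 0<K 0<L
      δ      = ε ℚ.* recip (K ℚ.+ L) 0<K+L
      0<δ    = *-pos 0<ε (recip-pos (K ℚ.+ L) 0<K+L)
      M , cx = cauchy x δ 0<δ
      N , cy = cauchy y δ 0<δ
  in (Nx ℕ.⊔ Ny) ℕ.⊔ (M ℕ.⊔ N) , λ m n le le′ →
    let Nx≤m = ℕ.m⊔n≤o⇒m≤o Nx Ny (ℕ.m⊔n≤o⇒m≤o (Nx ℕ.⊔ Ny) (M ℕ.⊔ N) le)
        Ny≤n = ℕ.m⊔n≤o⇒n≤o Nx Ny (ℕ.m⊔n≤o⇒m≤o (Nx ℕ.⊔ Ny) (M ℕ.⊔ N) le′)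
        MN≤m = ℕ.m⊔n≤o⇒n≤o (Nx ℕ.⊔ Ny) (M ℕ.⊔ N) le
        MN≤n = ℕ.m⊔n≤o⇒n≤o (Nx ℕ.⊔ Ny) (M ℕ.⊔ N) le′
        dx   = cx m n (ℕ.m⊔n≤o⇒m≤o M N MN≤m) (ℕ.m⊔n≤o⇒m≤o M N MN≤n)
        dy   = cy m n (ℕ.m⊔n≤o⇒n≤o M N MN≤m) (ℕ.m⊔n≤o⇒n≤o M N MN≤n)
    in *-estimate (seq x m) (seq y m) (seq x n) (seq y n) K L ε 0<K 0<L 0<K+L
         (hx m Nx≤m) (hy n Ny≤n) dx dy

_^_ : ℝ → ℕ → ℝ
x ^ zero  = 1ℝ
x ^ suc n = x * x ^ n

-- If seq x is bounded below by c > 0 from some index on, then replacing seq x n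
-- by seq x n ⊔ c changes no late term and makes every term invertible.
reciprocal : (x : ℝ) → 0ℝ < x → ℝ
reciprocal x (c , 0<c , _) .seq n =
  recip (seq x n ℚ.⊔ c) (ℚ.<-≤-trans 0<c (ℚ.p≤q⊔p (seq x n) c))
reciprocal x (c , 0<c , _) .cauchy ε 0<ε =
  let N , h = cauchy x (ε ℚ.* (c ℚ.* c)) (*-pos 0<ε (*-pos 0<c 0<c))
  in N , λ m n le le′ →
    recip-estimate (seq x m ℚ.⊔ c) (seq x n ℚ.⊔ c) c ε
      (ℚ.<-≤-trans 0<c (ℚ.p≤q⊔p (seq x m) c)) (ℚ.<-≤-trans 0<c (ℚ.p≤q⊔p (seq x n) c)) 0<c
      (ℚ.p≤q⊔p (seq x m) c) (ℚ.p≤q⊔p (seq x n) c)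
      (ℚ.≤-trans (∣p⊔r-q⊔r∣≤∣p-q∣ (seq x m) (seq x n) c) (h m n le le′))

-- 1 + 2⁻ˢ + ⋯ + n⁻ˢ; for s ≥ 2 the error after n terms is at most 1/n.
ζ-partial : ℕ → ℕ → ℚ
ζ-partial s zero    = 0ℚ
ζ-partial s (suc n) = ζ-partial s n ℚ.+ 1/ℕ (suc n ℕ.^ s) {{ℕ.m^n≢0 (suc n) s}}

module _ (s : ℕ) (1<s : 1 ℕ.< s) where

  private
    S = ζ-partial s

    S-step : ∀ n → S n ℚ.≤ S (suc n)
    S-step n = ℚ.≤-trans (ℚ.≤-reflexive (sym (ℚ.+-identityʳ (S n))))
      (ℚ.+-monoʳ-≤ (S n) (ℚ.<⇒≤ (0<1/ℕ (suc n ℕ.^ s) {{ℕ.m^n≢0 (suc n) s}})))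

    S-mono : ∀ k n → S n ℚ.≤ S (k ℕ.+ n)
    S-mono zero    n = ℚ.≤-refl
    S-mono (suc k) n = ℚ.≤-trans (S-mono k n) (S-step (k ℕ.+ n))

    term-bound : ∀ n → let instance _ = ℕ.m^n≢0 (suc (suc n)) s in
                 1/ℕ (suc (suc n) ℕ.^ s) ℚ.+ 1/ℕ (suc (suc n)) ℚ.≤ 1/ℕ (suc n)
    term-bound n = ℚ.≤-trans
      (ℚ.+-monoˡ-≤ (1/ℕ (suc (suc n)))
        (1/ℕ-antimono (suc n ℕ.* suc (suc n)) (suc (suc n) ℕ.^ s) {{_}} {{ℕ.m^n≢0 (suc (suc n)) s}}
          (ℕ.≤-trans (ℕ.*-monoˡ-≤ (suc (suc n)) (ℕ.n≤1+n (suc n)))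
            (ℕ.≤-trans (ℕ.≤-reflexive (cong (suc (suc n) ℕ.*_) (sym (ℕ.*-identityʳ (suc (suc n))))))
              (ℕ.^-monoʳ-≤ (suc (suc n)) 1<s)))))
      (ℚ.≤-reflexive (1/ℕ-telescope n))

    S-tail : ∀ k n → S (k ℕ.+ suc n) ℚ.+ 1/ℕ (suc (k ℕ.+ n)) ℚ.≤ S (suc n) ℚ.+ 1/ℕ (suc n)
    S-tail zero    n = ℚ.≤-refl
    S-tail (suc k) n rewrite ℕ.+-suc k n = ℚ.≤-trans
      (ℚ.≤-reflexive (ℚ.+-assoc (S (suc (k ℕ.+ n))) _ (1/ℕ (suc (suc (k ℕ.+ n))))))
      (ℚ.≤-trans (ℚ.+-monoʳ-≤ (S (suc (k ℕ.+ n))) (term-bound (k ℕ.+ n)))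
        (subst (λ j → S j ℚ.+ 1/ℕ (suc (k ℕ.+ n)) ℚ.≤ S (suc n) ℚ.+ 1/ℕ (suc n))
               (ℕ.+-suc k n) (S-tail k n)))

    S-upper : ∀ k n → S (k ℕ.+ suc n) ℚ.≤ S (suc n) ℚ.+ 1/ℕ (suc n)
    S-upper k n = ℚ.≤-trans (ℚ.≤-reflexive (sym (ℚ.+-identityʳ _)))
      (ℚ.≤-trans (ℚ.+-monoʳ-≤ (S (k ℕ.+ suc n)) (ℚ.<⇒≤ (0<1/ℕ (suc (k ℕ.+ n))))) (S-tail k n))

    half : ∀ N m n → suc N ℕ.≤ m → suc N ℕ.≤ n → S m ℚ.≤ S n ℚ.+ 1/ℕ (suc N)
    half N m n N<m N<n = subst₂ (λ a b → S a ℚ.≤ S b ℚ.+ 1/ℕ (suc N))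
      (ℕ.m∸n+n≡m N<m) (ℕ.m∸n+n≡m N<n)
      (ℚ.≤-trans (S-upper (m ℕ.∸ suc N) N) (ℚ.+-monoˡ-≤ (1/ℕ (suc N)) (S-mono (n ℕ.∸ suc N) (suc N))))

  ζ : ℝ
  ζ .seq    = ζ-partial s
  ζ .cauchy ε 0<ε = ℚ.↧ₙ ε , λ m n le le′ →
    ℚ.≤-trans (∣p-q∣≤r (half (ℚ.ℚ.denominator-1 ε) m n le le′) (half (ℚ.ℚ.denominator-1 ε) n m le′ le))
              (1/ℕ-archimedean 0<ε)

  ζ-pos : 0ℝ < ζ
  ζ-pos = 1/ℕ 1 , 0<1/ℕ 1 , 1 , λ n 1≤n →
    subst (λ j → 0ℚ ℚ.+ 1/ℕ 1 ℚ.≤ S j) (ℕ.m∸n+n≡m 1≤n)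
      (ℚ.≤-trans (ℚ.≤-reflexive (cong (0ℚ ℚ.+_) first-term)) (S-mono (n ℕ.∸ 1) 1))
    where
    first-term : 1/ℕ 1 ≡ 1/ℕ (1 ℕ.^ s) {{ℕ.m^n≢0 1 s}}
    first-term = ℚ./-cong {p₁ = + 1} {q₁ = 1} {p₂ = + 1} {q₂ = 1 ℕ.^ s} {{_}} {{ℕ.m^n≢0 1 s}} refl (sym (ℕ.^-zeroˡ s))

-- E A B stands for the curve y² = x³ + Ax + B.
record Curve : Set where
  constructor E
  field
    A B : ℤ

disc : Curve → ℤ
disc (E A B) = ℤ.- (+ 16) ℤ.* (+ 4 ℤ.* A ℤ.^ 3 ℤ.+ + 27 ℤ.* B ℤ.^ 2)

ℰ̃ : Pred Curve 0ℓ
ℰ̃ C = disc C ≢ 0ℤ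

ℰ : Pred Curve 0ℓ
ℰ C@(E A B) = ℰ̃ C × ¬ (∃[ p ] ℕ.Prime p × + (p ℕ.^ 4) ℤ.∣ A × + (p ℕ.^ 6) ℤ.∣ B)

H : (α β : ℝ) → Curve → ℝ
H α β (E A B) = (α * fromℤ (+ ℤ.∣ A ∣) ^ 3) ⊔ (β * fromℤ B ^ 2)

_⟨_⨾_⟩ : Pred Curve 0ℓ → ℝ → (Curve → ℝ) → Pred Curve 0ℓ
(ℱ ⟨ X ⨾ h ⟩) C = ℱ C × h C ≤ X

-- P holds of exactly n elements.  Membership in a family cut out by a real
-- inequality is not decidable, so cardinality is a relation, not a function.
HasCardinality : {A : Set} → Pred A 0ℓ → ℕ → Set
HasCardinality P n = ∃[ xs ] Unique xs × (∀ x → x ∈ xs ⇔ P x) × length xs ≡ n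

-- r is the positive real number X^(-1/3)
_Is_^-⅓ : ℝ → ℝ → Set
r Is X ^-⅓ = 0ℝ < r × r ^ 3 * X ≈ 1ℝ

{-# OPTIONS --safe #-}
module Submission where

-- Let a and b be the largest |A| and |B| allowed by the height, so that the curves counted are
-- those with |A| ≤ a and |B| ≤ b.  Every nonsingular (A , B) is (d⁴A′ , d⁶B′) for exactly one
-- d ≥ 1 and one (A′ , B′) ∈ ℰ.  With M and n counting the nonsingular and the minimal curves in
-- a box, this gives M(a , b) = Σ_d n(⌊a/d⁴⌋ , ⌊b/d⁶⌋).  Instead of inverting this by the Möbius
-- function, one shows |n(a , b) s - 4ab| ≤ 12 (a + b), s a late partial sum of ζ(10), by strong
-- induction: all terms with d ≥ 2 are known, the main terms add up because ⌊a/d⁴⌋⌊b/d⁶⌋ ≈ ab/d¹⁰,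
-- and the errors shrink because Σ_{d≥2} 1/d⁴ ≤ 1/2.  Since 4ab ≤ M ≤ 4ab + 2 (a + b), the ratio
-- n/M differs from 1/s by O(1/a + 1/b), and α (a+1)³ > X, β (b+1)² > X bound this by O(X^(-1/3)).

open import Defs
open ℚ-Facts
import Algebra.Properties.Group as Group
open import Algebra.Bundles using (AbelianGroup)
open import Data.Integer.Base as ℤ using (ℤ; +_; 0ℤ; -[1+_])
import Data.Integer.Divisibility.Signed as Signed
import Data.Integer.Properties as ℤ
import Data.Integer.Solver as ℤ-Solver
open import Data.List.Base using (List; []; _∷_; _++_; length; map; filter; upTo; cartesianProductWith)
import Data.List.Membership.DecPropositional as DecMembership
open import Data.List.Membership.Propositional using (_∈_)
import Data.List.Membership.Propositional.Properties as ∈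
import Data.List.Properties as List
open import Data.List.Relation.Unary.All using (All; []; _∷_)
import Data.List.Relation.Unary.All as All
open import Data.List.Relation.Unary.AllPairs using ([]; _∷_)
open import Data.List.Relation.Unary.Any using (here; there)
open import Data.List.Relation.Unary.Unique.Propositional using (Unique)
import Data.List.Relation.Unary.Unique.Propositional.Properties as Unique
open import Data.Nat.Base as ℕ using (ℕ; zero; suc; z≤n; s≤s)
open import Data.Nat.Coprimality as Coprimality using (Coprime)
import Data.Nat.Divisibility as ℕ
import Data.Nat.DivMod as ℕ
import Data.Nat.GCD as ℕ
open import Data.Nat.Induction using (<-wellFounded)
import Data.Nat.Primality as ℕ
open import Data.Nat.Primality.Factorisation using (factorise)
import Data.Nat.Properties as ℕ
open import Data.Nat.Tactic.RingSolver using (solve-∀)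
open import Data.Product.Base using (_×_; _,_; proj₁; proj₂; ∃-syntax; Σ-syntax)
open import Data.Rational.Base as ℚ using (ℚ; 0ℚ; 1ℚ; ½)
import Data.Rational.Properties as ℚ
import Data.Rational.Solver as ℚ-Solver
import Data.Rational.Unnormalised.Base as ℚᵘ
import Data.Rational.Unnormalised.Properties as ℚᵘ
open import Data.Sum.Base using (_⊎_; inj₁; inj₂; [_,_]′)
open import Function.Base using (_∘_)
open import Function.Bundles using (_⇔_; mk⇔; Equivalence)
open import Induction.WellFounded using (Acc; acc)
open import Level using (0ℓ)
open import Relation.Binary.Definitions using (DecidableEquality; tri<; tri≈; tri>)
open import Relation.Binary.PropositionalEquality
open import Relation.Nullary.Decidable using (Dec; yes; no; map′; _×-dec_; ¬?; decidable-stable; toSum)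
open import Relation.Nullary.Negation.Core using (¬_; contradiction)
open import Relation.Unary using (Pred)

-- Scaling of curves and minimal models

-- Inequalities between Cauchy reals are undecidable, so a and b cannot be computed as floors of
-- roots of X. They are read off the finite list that witnesses the cardinality of the nonsingular
-- curves. Nor does the counting see ζ(10) itself. A curve in the box has scaling factor at most
-- max(a , b), so all further levels are empty and s may be any later partial sum. It stays fixed
-- while the induction shrinks the box, and the late terms of the sequence defining 1/ζ(10) are
-- exactly such numbers 1/s. The constant 12: suppose that the error is E (a + b). Rounding down to
-- ⌊a/d⁴⌋ and ⌊b/d⁶⌋ costs another 4, so the levels d ≥ 2 contribute at most (E + 4)/2. The bound M
-- ≤ 4ab + 2 (a + b), multiplied by s ≤ 3/2, contributes 3. The induction closes once (E + 4)/2 + 3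
-- ≤ E, that is, for E ≥ 10. An additive constant in the error would be summed once per level and
-- grow with N. None arises, because the curve (0 , 0) is singular and its removal makes the upper
-- bound for M homogeneous.

module _ {A B : Set} where

  -- Delete `f x` from `ys`: by injectivity the images of the remaining elements survive. This
  -- pigeonhole principle is applied to the identity for inclusions, to `Curve.B` for singular
  -- curves, and to embeddings of ℕ to bound `a` and `b`.
  length-injective : (f : A → B) {xs : List A} {ys : List B} → Unique xs →
                     (∀ {x} → x ∈ xs → f x ∈ ys) →
                     (∀ {x y} → x ∈ xs → y ∈ xs → f x ≡ f y → x ≡ y) →
                     length xs ℕ.≤ length ys
  length-injective f {[]}     []             f∈ inj = z≤n
  length-injective f {x ∷ xs} (x∉xs ∷ xs-unique) f∈ inj with ∈.∈-∃++ (f∈ (here refl))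
  ... | us , vs , refl = begin
    suc (length xs)              ≤⟨ s≤s (length-injective f xs-unique remaining (λ y z → inj (there y) (there z))) ⟩
    suc (length (us ++ vs))      ≡⟨ cong suc (List.length-++ us) ⟩
    suc (length us ℕ.+ length vs) ≡⟨ ℕ.+-suc (length us) (length vs) ⟨
    length us ℕ.+ suc (length vs) ≡⟨ List.length-++ us ⟨
    length (us ++ f x ∷ vs)      ∎
    where
    open ℕ.≤-Reasoning
    remaining : ∀ {y} → y ∈ xs → f y ∈ us ++ vs
    remaining y∈xs with ∈.∈-++⁻ us (f∈ (there y∈xs))
    ... | inj₁ ∈us          = ∈.∈-++⁺ˡ ∈us
    ... | inj₂ (there ∈vs)  = ∈.∈-++⁺ʳ us ∈vs
    ... | inj₂ (here fy≡fx) =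
      contradiction (inj (here refl) (there y∈xs) (sym fy≡fx)) (All.lookup x∉xs y∈xs)

length-≡ : {A : Set} {xs ys : List A} → Unique xs → Unique ys →
           (∀ {x} → x ∈ xs → x ∈ ys) → (∀ {x} → x ∈ ys → x ∈ xs) → length xs ≡ length ys
length-≡ uxs uys xs⊆ys ys⊆xs = ℕ.≤-antisym
  (length-injective (λ x → x) uxs xs⊆ys (λ _ _ eq → eq))
  (length-injective (λ x → x) uys ys⊆xs (λ _ _ eq → eq))

coprime-* : ∀ {m n o} → Coprime m n → Coprime m o → Coprime m (n ℕ.* o)
coprime-* {m} {n} {o} m⊥n m⊥o {k} (k∣m , k∣no) =
  m⊥o (k∣m , Coprimality.coprime-divisor k⊥n k∣no)
  where
  k⊥n : Coprime k n
  k⊥n (j∣k , j∣n) = m⊥n (ℕ.∣-trans j∣k k∣m , j∣n)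

coprime-^ : ∀ {m n} k → Coprime m n → Coprime m (n ℕ.^ k)
coprime-^ zero    m⊥n = Coprimality.sym (Coprimality.1-coprimeTo _)
coprime-^ (suc k) m⊥n = coprime-* m⊥n (coprime-^ k m⊥n)

^-monoˡ-∣ : ∀ {m n} k → m ℕ.∣ n → m ℕ.^ k ℕ.∣ n ℕ.^ k
^-monoˡ-∣ zero    m∣n = ℕ.∣-refl
^-monoˡ-∣ (suc k) m∣n = ℕ.*-pres-∣ m∣n (^-monoˡ-∣ k m∣n)

^-distribʳ-* : ∀ m n k → (m ℕ.* n) ℕ.^ k ≡ m ℕ.^ k ℕ.* n ℕ.^ k
^-distribʳ-* m n zero    = refl
^-distribʳ-* m n (suc k) rewrite ^-distribʳ-* m n k =
  ℕ.[m*n]*[o*p]≡[m*o]*[n*p] m n (m ℕ.^ k) (n ℕ.^ k)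

n≤n^1+k : ∀ n k → n ℕ.≤ n ℕ.^ suc k
n≤n^1+k zero    k = z≤n
n≤n^1+k n@(suc _) k = ℕ.m≤m*n n (n ℕ.^ k) {{ℕ.m^n≢0 n k}}

prime-divisor : ∀ n → n ≢ 0 → n ≢ 1 → ∃[ p ] ℕ.Prime p × p ℕ.∣ n
prime-divisor n n≢0 n≢1 with factorise n {{ℕ.≢-nonZero n≢0}}
... | record { factors = [] ; isFactorisation = eq } = contradiction eq n≢1
... | record { factors = p ∷ ps ; isFactorisation = refl ; factorsPrime = pp ∷ _ } =
  p , pp , ℕ.m∣m*n _

coprime-cofactors : ∀ d e .{{_ : ℕ.NonZero d}} →
                    ∃[ g ] ∃[ d′ ] ∃[ e′ ] d ≡ d′ ℕ.* g × e ≡ e′ ℕ.* g × Coprime d′ e′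
coprime-cofactors d e = ℕ.gcd d e , _ , _ ,
  sym (ℕ.m/n*n≡m (ℕ.gcd[m,n]∣m d e)) , sym (ℕ.m/n*n≡m (ℕ.gcd[m,n]∣n d e)) , Coprimality.coprime-/gcd d e
  where
  instance
    gcd≢0 : ℕ.NonZero (ℕ.gcd d e)
    gcd≢0 = ℕ.≢-nonZero (ℕ.gcd[m,n]≢0 d e (inj₁ (ℕ.≢-nonZero⁻¹ d)))

-- Cancelling `g ^ k` leaves `d ^ k * x ≡ e ^ k * y` with coprime powers `d ^ k` and `e ^ k`.
cofactor-∣ : ∀ g {d e} .{{_ : ℕ.NonZero g}} k {x y} → Coprime d e →
             (d ℕ.* g) ℕ.^ k ℕ.* x ≡ (e ℕ.* g) ℕ.^ k ℕ.* y → e ℕ.^ k ℕ.∣ x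
cofactor-∣ g {d} {e} k {x} {y} d⊥e eq =
  Coprimality.coprime-divisor
    (coprime-^ k (Coprimality.sym (coprime-^ k d⊥e)))
    (ℕ.divides y (ℕ.*-cancelˡ-≡ _ _ (g ℕ.^ k) {{ℕ.m^n≢0 g k}} (begin
      g ℕ.^ k ℕ.* (d ℕ.^ k ℕ.* x)  ≡⟨ shift d x ⟩
      (d ℕ.* g) ℕ.^ k ℕ.* x        ≡⟨ eq ⟩
      (e ℕ.* g) ℕ.^ k ℕ.* y        ≡⟨ shift e y ⟨
      g ℕ.^ k ℕ.* (e ℕ.^ k ℕ.* y)  ≡⟨ cong (g ℕ.^ k ℕ.*_) (ℕ.*-comm (e ℕ.^ k) y) ⟩
      g ℕ.^ k ℕ.* (y ℕ.* e ℕ.^ k)  ∎)))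
  where
  open ≡-Reasoning
  shift : ∀ u z → g ℕ.^ k ℕ.* (u ℕ.^ k ℕ.* z) ≡ (u ℕ.* g) ℕ.^ k ℕ.* z
  shift u z = begin
    g ℕ.^ k ℕ.* (u ℕ.^ k ℕ.* z)  ≡⟨ ℕ.*-assoc (g ℕ.^ k) (u ℕ.^ k) z ⟨
    g ℕ.^ k ℕ.* u ℕ.^ k ℕ.* z    ≡⟨ cong (ℕ._* z) (ℕ.*-comm (g ℕ.^ k) (u ℕ.^ k)) ⟩
    u ℕ.^ k ℕ.* g ℕ.^ k ℕ.* z    ≡⟨ cong (ℕ._* z) (^-distribʳ-* u g k) ⟨
    (u ℕ.* g) ℕ.^ k ℕ.* z        ∎

Reducible : Curve → ℕ → Set
Reducible (E A B) p = ℕ.Prime p × p ℕ.^ 4 ℕ.∣ ℤ.∣ A ∣ × p ℕ.^ 6 ℕ.∣ ℤ.∣ B ∣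

-- scale d C is ℚ-isomorphic to C.
scale : ℕ → Curve → Curve
scale d (E A B) = E (+ (d ℕ.^ 4) ℤ.* A) (+ (d ℕ.^ 6) ℤ.* B)

∣+∣-homo : ∀ n A → ℤ.∣ + n ℤ.* A ∣ ≡ n ℕ.* ℤ.∣ A ∣
∣+∣-homo n A = ℤ.abs-* (+ n) A

-- A prime p dividing `e` would give p⁴ ∣ A and p⁶ ∣ B by `cofactor-∣`, against the minimality of
-- the first curve.
scale-cofactor≡1 : ∀ g {d e} C C′ .{{_ : ℕ.NonZero g}} → e ≢ 0 → Coprime d e →
                   ℰ C → scale (d ℕ.* g) C ≡ scale (e ℕ.* g) C′ → e ≡ 1
scale-cofactor≡1 g {d} {e} (E A B) (E A′ B′) e≢0 d⊥e (_ , reduced) eq =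
  decidable-stable (e ℕ.≟ 1) λ e≢1 →
    let p , p-prime , p∣e = prime-divisor e e≢0 e≢1 in
    reduced (p , p-prime ,
      ℕ.∣-trans (^-monoˡ-∣ 4 p∣e) (cofactor-∣ g 4 d⊥e (abs-eq 4 {A} {A′} (cong Curve.A eq))) ,
      ℕ.∣-trans (^-monoˡ-∣ 6 p∣e) (cofactor-∣ g 6 d⊥e (abs-eq 6 {B} {B′} (cong Curve.B eq))))
  where
  abs-eq : ∀ k {X Y} → + ((d ℕ.* g) ℕ.^ k) ℤ.* X ≡ + ((e ℕ.* g) ℕ.^ k) ℤ.* Y →
           (d ℕ.* g) ℕ.^ k ℕ.* ℤ.∣ X ∣ ≡ (e ℕ.* g) ℕ.^ k ℕ.* ℤ.∣ Y ∣
  abs-eq k {X} {Y} eq =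
    trans (sym (∣+∣-homo ((d ℕ.* g) ℕ.^ k) X)) (trans (cong ℤ.∣_∣ eq) (∣+∣-homo ((e ℕ.* g) ℕ.^ k) Y))

-- Divide both factors by their gcd `g`. The cofactor `e′` is 1 by minimality of `C`, and `d′` is 1
-- by minimality of `C′`.
scale-unique : ∀ d e .{{_ : ℕ.NonZero d}} .{{_ : ℕ.NonZero e}} C C′ →
               ℰ C → ℰ C′ → scale d C ≡ scale e C′ → d ≡ e
scale-unique d e C C′ ℰC ℰC′ eq =
  let g , d′ , e′ , d≡d′g , e≡e′g , d′⊥e′ = coprime-cofactors d e
      g≢0  = λ g≡0 → ℕ.≢-nonZero⁻¹ d (trans d≡d′g (trans (cong (d′ ℕ.*_) g≡0) (ℕ.*-zeroʳ d′)))
      d′≢0 = λ d′≡0 → ℕ.≢-nonZero⁻¹ d (trans d≡d′g (cong (ℕ._* g) d′≡0))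
      e′≢0 = λ e′≡0 → ℕ.≢-nonZero⁻¹ e (trans e≡e′g (cong (ℕ._* g) e′≡0))
      eq′  = trans (cong (λ n → scale n C) (sym d≡d′g)) (trans eq (cong (λ n → scale n C′) e≡e′g))
      d′≡1 = scale-cofactor≡1 g C′ C {{ℕ.≢-nonZero g≢0}} d′≢0 (Coprimality.sym d′⊥e′) ℰC′ (sym eq′)
      e′≡1 = scale-cofactor≡1 g C C′ {{ℕ.≢-nonZero g≢0}} e′≢0 d′⊥e′ ℰC eq′
  in trans d≡d′g (trans (cong (ℕ._* g) (trans d′≡1 (sym e′≡1))) (sym e≡e′g))

scale-injective : ∀ d .{{_ : ℕ.NonZero d}} C C′ → scale d C ≡ scale d C′ → C ≡ C′
scale-injective d (E A B) (E A′ B′) eq = cong₂ E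
  (ℤ.*-cancelˡ-≡ (+ (d ℕ.^ 4)) A A′ {{ℕ.m^n≢0 d 4}} (cong Curve.A eq))
  (ℤ.*-cancelˡ-≡ (+ (d ℕ.^ 6)) B B′ {{ℕ.m^n≢0 d 6}} (cong Curve.B eq))

scale-∘ : ∀ d e C → scale d (scale e C) ≡ scale (d ℕ.* e) C
scale-∘ d e (E A B) = cong₂ E (coefficient 4 A) (coefficient 6 B)
  where
  coefficient : ∀ k X → + (d ℕ.^ k) ℤ.* (+ (e ℕ.^ k) ℤ.* X) ≡ + ((d ℕ.* e) ℕ.^ k) ℤ.* X
  coefficient k X = begin
    + (d ℕ.^ k) ℤ.* (+ (e ℕ.^ k) ℤ.* X)    ≡⟨ ℤ.*-assoc (+ (d ℕ.^ k)) (+ (e ℕ.^ k)) X ⟨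
    + (d ℕ.^ k) ℤ.* + (e ℕ.^ k) ℤ.* X      ≡⟨ cong (ℤ._* X) (ℤ.pos-* (d ℕ.^ k) (e ℕ.^ k)) ⟨
    + (d ℕ.^ k ℕ.* e ℕ.^ k) ℤ.* X          ≡⟨ cong (λ n → + n ℤ.* X) (^-distribʳ-* d e k) ⟨
    + ((d ℕ.* e) ℕ.^ k) ℤ.* X              ∎
    where open ≡-Reasoning

scale-1 : ∀ C → scale 1 C ≡ C
scale-1 (E A B) = cong₂ E (ℤ.*-identityˡ A) (ℤ.*-identityˡ B)

pos-^ : ∀ m k → + (m ℕ.^ k) ≡ (+ m) ℤ.^ k
pos-^ m zero    = refl
pos-^ m (suc k) = trans (ℤ.pos-* m (m ℕ.^ k)) (cong (+ m ℤ.*_) (pos-^ m k))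

-- The discriminant is weighted homogeneous. With v = d² the powers d⁴, d⁶, d¹² become v², v³, v⁶,
-- which keeps the polynomial identity for the solver at low degree.
disc-weighted : ∀ v A B {x y z} → x ≡ v ℤ.^ 2 → y ≡ v ℤ.^ 3 → z ≡ v ℤ.^ 6 →
                disc (E (x ℤ.* A) (y ℤ.* B)) ≡ z ℤ.* disc (E A B)
disc-weighted v A B refl refl refl = identity v A B
  where
  open ℤ-Solver.+-*-Solver
  identity : ∀ v A B → disc (E (v ℤ.^ 2 ℤ.* A) (v ℤ.^ 3 ℤ.* B)) ≡ v ℤ.^ 6 ℤ.* disc (E A B)
  identity = solve 3 (λ v A B →
    con (ℤ.- + 16) :* (con (+ 4) :* (v :^ 2 :* A) :^ 3 :+ con (+ 27) :* (v :^ 3 :* B) :^ 2) :=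
    v :^ 6 :* (con (ℤ.- + 16) :* (con (+ 4) :* A :^ 3 :+ con (+ 27) :* B :^ 2))) refl

disc-scale : ∀ d C → disc (scale d C) ≡ + (d ℕ.^ 12) ℤ.* disc C
disc-scale d (E A B) = disc-weighted (+ (d ℕ.^ 2)) A B (square-^ 2) (square-^ 3) (square-^ 6)
  where
  square-^ : ∀ k → + (d ℕ.^ (2 ℕ.* k)) ≡ (+ (d ℕ.^ 2)) ℤ.^ k
  square-^ k = trans (cong +_ (sym (ℕ.^-*-assoc d 2 k))) (pos-^ (d ℕ.^ 2) k)

scale-ℰ̃⁻ : ∀ d C → ℰ̃ (scale d C) → ℰ̃ C
scale-ℰ̃⁻ d C ≢0 disc≡0 = ≢0 (trans (disc-scale d C) (trans (cong (+ (d ℕ.^ 12) ℤ.*_) disc≡0) (ℤ.*-zeroʳ (+ (d ℕ.^ 12)))))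

scale-ℰ̃⁺ : ∀ d .{{_ : ℕ.NonZero d}} C → ℰ̃ C → ℰ̃ (scale d C)
scale-ℰ̃⁺ d C ≢0 eq with ℤ.i*j≡0⇒i≡0∨j≡0 (+ (d ℕ.^ 12)) (trans (sym (disc-scale d C)) eq)
... | inj₁ d^12≡0 = ℕ.≢-nonZero⁻¹ (d ℕ.^ 12) {{ℕ.m^n≢0 d 12}} (ℤ.+-injective d^12≡0)
... | inj₂ disc≡0 = ≢0 disc≡0

ℰ̃? : ∀ C → Dec (ℰ̃ C)
ℰ̃? C = ¬? (disc C ℤ.≟ 0ℤ)

ℰ̃⇒nonzero : ∀ A B → ℰ̃ (E A B) → ℕ.NonZero ℤ.∣ A ∣ ⊎ ℕ.NonZero ℤ.∣ B ∣
ℰ̃⇒nonzero (+ suc _)  _ _ = inj₁ _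
ℰ̃⇒nonzero -[1+ _ ]   _ _ = inj₁ _
ℰ̃⇒nonzero (+ 0) (+ suc _) _ = inj₂ _
ℰ̃⇒nonzero (+ 0) -[1+ _ ]  _ = inj₂ _
ℰ̃⇒nonzero (+ 0) (+ 0) ≢0 = contradiction refl ≢0

∣^⇒≤ : ∀ {p n} k .{{_ : ℕ.NonZero n}} → p ℕ.^ suc k ℕ.∣ n → p ℕ.≤ n
∣^⇒≤ {p} k p^k∣n = ℕ.≤-trans (n≤n^1+k p k) (ℕ.∣⇒≤ p^k∣n)

-- Nonsingularity makes some coefficient nonzero, and a prime whose power divides it is at most its
-- absolute value. This bounds the search.
reducible? : ∀ C → ℰ̃ C → Dec (∃[ p ] Reducible C p)
reducible? (E A B) ≢0 = map′
  (λ (p , _ , r) → p , r)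
  (λ (p , r) → p , s≤s (bound r) , r)
  (ℕ.anyUpTo? (λ p → ℕ.prime? p ×-dec (p ℕ.^ 4 ℕ.∣? ℤ.∣ A ∣) ×-dec (p ℕ.^ 6 ℕ.∣? ℤ.∣ B ∣)) (suc (ℤ.∣ A ∣ ℕ.+ ℤ.∣ B ∣)))
  where
  bound : ∀ {p} → Reducible (E A B) p → p ℕ.≤ ℤ.∣ A ∣ ℕ.+ ℤ.∣ B ∣
  bound (_ , p⁴∣A , p⁶∣B) with ℰ̃⇒nonzero A B ≢0
  ... | inj₁ A≢0 = ℕ.≤-trans (∣^⇒≤ 3 {{A≢0}} p⁴∣A) (ℕ.m≤m+n _ _)
  ... | inj₂ B≢0 = ℕ.≤-trans (∣^⇒≤ 5 {{B≢0}} p⁶∣B) (ℕ.m≤n+m _ _)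

ℰ? : ∀ C → Dec (ℰ C)
ℰ? C with ℰ̃? C
... | no  ¬ℰ̃ = no (¬ℰ̃ ∘ proj₁)
... | yes ℰ̃C = map′ (ℰ̃C ,_) proj₂ (¬? (reducible? C ℰ̃C))

unscale : ∀ p C → Reducible C p → ∃[ C′ ] C ≡ scale p C′
unscale p (E A B) (_ , p⁴∣A , p⁶∣B) =
  let A′ , A≡ = divide {p ℕ.^ 4} A p⁴∣A
      B′ , B≡ = divide {p ℕ.^ 6} B p⁶∣B
  in E A′ B′ , cong₂ E A≡ B≡
  where
  divide : ∀ {n} X → n ℕ.∣ ℤ.∣ X ∣ → ∃[ Y ] X ≡ + n ℤ.* Y
  divide {n} X n∣X with Signed.∣ᵤ⇒∣ {+ n} {X} n∣X
  ... | Signed.divides Y eq = Y , trans eq (ℤ.*-comm Y (+ n))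

size : Curve → ℕ
size (E A B) = ℤ.∣ A ∣ ℕ.+ ℤ.∣ B ∣

scale-size : ∀ {p} C → ℰ̃ C → 1 ℕ.< p → size C ℕ.< size (scale p C)
scale-size {p} (E A B) ≢0 1<p = subst₂ (λ x y → size (E A B) ℕ.< x ℕ.+ y)
  (sym (∣+∣-homo (p ℕ.^ 4) A)) (sym (∣+∣-homo (p ℕ.^ 6) B))
  ([ (λ A≢0 → ℕ.+-mono-<-≤ (strict 3 A≢0) (weak 5)) , (λ B≢0 → ℕ.+-mono-≤-< (weak 3) (strict 5 B≢0)) ]′
    (ℰ̃⇒nonzero A B ≢0))
  where
  instance
    p≢0 : ℕ.NonZero p
    p≢0 = ℕ.>-nonZero (ℕ.<-trans (s≤s z≤n) 1<p)
  strict : ∀ k {x} → ℕ.NonZero x → x ℕ.< p ℕ.^ suc k ℕ.* x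
  strict k {x} x≢0 = subst (x ℕ.<_) (ℕ.*-comm x _) (ℕ.m<m*n x (p ℕ.^ suc k) {{x≢0}} (ℕ.<-≤-trans 1<p (n≤n^1+k p k)))
  weak : ∀ k {x} → x ℕ.≤ p ℕ.^ suc k ℕ.* x
  weak k {x} = ℕ.m≤n*m x (p ℕ.^ suc k) {{ℕ.m^n≢0 p (suc k)}}

-- Divide out p⁴ and p⁶ while some prime allows it. The process ends because a nonzero coefficient
-- shrinks each time, so `size` drops.
minimal-model : ∀ C → ℰ̃ C → ∃[ d ] ℕ.NonZero d × ∃[ C′ ] ℰ C′ × C ≡ scale d C′
minimal-model C = go C (<-wellFounded (size C))
  where
  go : ∀ C → Acc ℕ._<_ (size C) → ℰ̃ C → ∃[ d ] ℕ.NonZero d × ∃[ C′ ] ℰ C′ × C ≡ scale d C′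
  go C (acc rec) ℰ̃C with reducible? C ℰ̃C
  ... | no ¬reducible = 1 , _ , C , (ℰ̃C , ¬reducible) , sym (scale-1 C)
  ... | yes (p , red@(p-prime , _)) =
    let C₁ , C≡ = unscale p C red
        ℰ̃pC₁    = subst ℰ̃ C≡ ℰ̃C
        ℰ̃C₁     = scale-ℰ̃⁻ p C₁ ℰ̃pC₁
        size-<  = subst (λ D → size C₁ ℕ.< size D) (sym C≡)
                    (scale-size {p} C₁ ℰ̃C₁ (ℕ.nonTrivial⇒n>1 p {{ℕ.prime⇒nonTrivial p-prime}}))
        d , d≢0 , C₂ , ℰC₂ , C₁≡ = go C₁ (rec size-<) ℰ̃C₁
    in p ℕ.* d , ℕ.m*n≢0 p d {{ℕ.prime⇒nonZero p-prime}} {{d≢0}} , C₂ , ℰC₂ ,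
       trans C≡ (trans (cong (scale p) C₁≡) (scale-∘ p d C₂))

-- Curves in a box

interval : ℕ → List ℤ
interval n = map +_ (upTo (suc n)) ++ map -[1+_] (upTo n)

∈-interval⁺ : ∀ {n} X → ℤ.∣ X ∣ ℕ.≤ n → X ∈ interval n
∈-interval⁺ (+ m)    m≤n = ∈.∈-++⁺ˡ (∈.∈-map⁺ +_ (∈.∈-upTo⁺ (s≤s m≤n)))
∈-interval⁺ -[1+ m ] m<n = ∈.∈-++⁺ʳ (map +_ (upTo _)) (∈.∈-map⁺ -[1+_] (∈.∈-upTo⁺ m<n))

∈-interval⁻ : ∀ {n X} → X ∈ interval n → ℤ.∣ X ∣ ℕ.≤ n
∈-interval⁻ {n} X∈ with ∈.∈-++⁻ (map +_ (upTo (suc n))) X∈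
... | inj₁ X∈₊ with ∈.∈-map⁻ +_ X∈₊
...   | m , m∈ , refl = ℕ.≤-pred (∈.∈-upTo⁻ m∈)
∈-interval⁻ {n} X∈ | inj₂ X∈₋ with ∈.∈-map⁻ -[1+_] X∈₋
...   | m , m∈ , refl = ∈.∈-upTo⁻ m∈

interval-unique : ∀ n → Unique (interval n)
interval-unique n = Unique.++⁺
  (Unique.map⁺ ℤ.+-injective (Unique.upTo⁺ (suc n)))
  (Unique.map⁺ ℤ.-[1+-injective (Unique.upTo⁺ n))
  λ (X∈₊ , X∈₋) → disjoint (∈.∈-map⁻ +_ X∈₊) (∈.∈-map⁻ -[1+_] X∈₋)
  where
  disjoint : ∀ {X : ℤ} → (∃[ m ] m ∈ upTo (suc n) × X ≡ + m) → ¬ (∃[ m ] m ∈ upTo n × X ≡ -[1+ m ])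
  disjoint (_ , _ , refl) (_ , _ , ())

length-interval : ∀ n → length (interval n) ≡ suc (2 ℕ.* n)
length-interval n = begin
  length (map +_ (upTo (suc n)) ++ map -[1+_] (upTo n))  ≡⟨ List.length-++ (map +_ (upTo (suc n))) ⟩
  length (map +_ (upTo (suc n))) ℕ.+ length (map -[1+_] (upTo n))
    ≡⟨ cong₂ ℕ._+_ (trans (List.length-map +_ (upTo (suc n))) (List.length-upTo (suc n)))
                   (trans (List.length-map -[1+_] (upTo n)) (List.length-upTo n)) ⟩
  suc n ℕ.+ n                                            ≡⟨ cong (λ m → suc (n ℕ.+ m)) (ℕ.+-identityʳ n) ⟨
  suc (2 ℕ.* n)                                          ∎
  where open ≡-Reasoning

InBox : ℕ → ℕ → Curve → Set
InBox a b (E A B) = ℤ.∣ A ∣ ℕ.≤ a × ℤ.∣ B ∣ ℕ.≤ b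

opaque
  box : ℕ → ℕ → List Curve
  box a b = cartesianProductWith E (interval a) (interval b)

  ∈-box⁺ : ∀ {a b} C → InBox a b C → C ∈ box a b
  ∈-box⁺ (E A B) (A≤a , B≤b) = ∈.∈-cartesianProductWith⁺ E (∈-interval⁺ A A≤a) (∈-interval⁺ B B≤b)

  ∈-box⁻ : ∀ a b {C} → C ∈ box a b → InBox a b C
  ∈-box⁻ a b C∈ with ∈.∈-cartesianProductWith⁻ E (interval a) (interval b) C∈
  ... | A , B , A∈ , B∈ , refl = ∈-interval⁻ A∈ , ∈-interval⁻ B∈

  box-unique : ∀ a b → Unique (box a b)
  box-unique a b = Unique.cartesianProductWith⁺ E (λ { refl → refl , refl }) (interval-unique a) (interval-unique b)

  length-box : ∀ a b → length (box a b) ≡ suc (2 ℕ.* a) ℕ.* suc (2 ℕ.* b)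
  length-box a b = trans (length-product (interval a))
                         (cong₂ ℕ._*_ (length-interval a) (length-interval b))
    where
    length-product : ∀ As → length (cartesianProductWith E As (interval b)) ≡ length As ℕ.* length (interval b)
    length-product []       = refl
    length-product (A ∷ As) = trans (List.length-++ (map (E A) (interval b)))
      (cong₂ ℕ._+_ (List.length-map (E A) (interval b)) (length-product As))

nonsingular minimal : ℕ → ℕ → List Curve
nonsingular a b = filter ℰ̃? (box a b)
minimal     a b = filter ℰ? (box a b)

#nonsingular #minimal : ℕ → ℕ → ℕ
#nonsingular a b = length (nonsingular a b)
#minimal     a b = length (minimal a b)

abs-^ : ∀ X k → ℤ.∣ X ℤ.^ k ∣ ≡ ℤ.∣ X ∣ ℕ.^ k
abs-^ X zero    = refl
abs-^ X (suc k) = trans (ℤ.abs-* X (X ℤ.^ k)) (cong (ℤ.∣ X ∣ ℕ.*_) (abs-^ X k))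

^-injectiveˡ : ∀ k .{{_ : ℕ.NonZero k}} {m n} → m ℕ.^ k ≡ n ℕ.^ k → m ≡ n
^-injectiveˡ k {m} {n} eq with ℕ.<-cmp m n
... | tri< m<n _ _ = contradiction eq (ℕ.<⇒≢ (ℕ.^-monoˡ-< k m<n))
... | tri≈ _ m≡n _ = m≡n
... | tri> _ _ n<m = contradiction (sym eq) (ℕ.<⇒≢ (ℕ.^-monoˡ-< k n<m))

cube-injective : ∀ X Y → X ℤ.^ 3 ≡ Y ℤ.^ 3 → X ≡ Y
cube-injective X Y eq = same-sign X Y eq
  (^-injectiveˡ 3 (trans (sym (abs-^ X 3)) (trans (cong ℤ.∣_∣ eq) (abs-^ Y 3))))
  where
  same-sign : ∀ X Y → X ℤ.^ 3 ≡ Y ℤ.^ 3 → ℤ.∣ X ∣ ≡ ℤ.∣ Y ∣ → X ≡ Y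
  same-sign (+ m)    (+ n)    _  m≡n = cong +_ m≡n
  same-sign -[1+ m ] -[1+ n ] _  m≡n = cong -[1+_] (ℕ.suc-injective m≡n)
  same-sign (+ m)    -[1+ n ] eq _   = contradiction (trans (pos-^ m 3) eq) λ ()
  same-sign -[1+ m ] (+ n)    eq _   = contradiction (trans (pos-^ n 3) (sym eq)) λ ()

disc-injectiveˡ : ∀ A A′ B → disc (E A B) ≡ disc (E A′ B) → A ≡ A′
disc-injectiveˡ A A′ B eq = cube-injective A A′
  (ℤ.*-cancelˡ-≡ (+ 4) (A ℤ.^ 3) (A′ ℤ.^ 3)
    (+-cancelʳ (+ 4 ℤ.* A ℤ.^ 3) (+ 4 ℤ.* A′ ℤ.^ 3)
      (ℤ.*-cancelˡ-≡ (ℤ.- + 16) (+ 4 ℤ.* A ℤ.^ 3 ℤ.+ + 27 ℤ.* B ℤ.^ 2) (+ 4 ℤ.* A′ ℤ.^ 3 ℤ.+ + 27 ℤ.* B ℤ.^ 2) eq)))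
  where
  +-cancelʳ : ∀ X Y {Z} → X ℤ.+ Z ≡ Y ℤ.+ Z → X ≡ Y
  +-cancelʳ X Y {Z} = Group.∙-cancelʳ (AbelianGroup.group ℤ.+-0-abelianGroup) Z X Y

-- Cubing is injective on ℤ, so each B admits at most one A of discriminant zero. Hence at most 2b +
-- 1 curves of the box are singular, and at least 2a (2b + 1) ≥ 4ab remain.
#nonsingular-lower : ∀ a b → 4 ℕ.* (a ℕ.* b) ℕ.≤ #nonsingular a b
#nonsingular-lower a b = ℕ.+-cancelʳ-≤ (suc (2 ℕ.* b)) _ _ (begin
  4 ℕ.* (a ℕ.* b) ℕ.+ suc (2 ℕ.* b)              ≤⟨ ℕ.m≤n+m _ (2 ℕ.* a) ⟩
  2 ℕ.* a ℕ.+ (4 ℕ.* (a ℕ.* b) ℕ.+ suc (2 ℕ.* b)) ≡⟨ identity a b ⟩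
  suc (2 ℕ.* a) ℕ.* suc (2 ℕ.* b)                ≡⟨ length-box a b ⟨
  length (box a b)                                ≤⟨ length-injective (λ C → C) (box-unique a b) split (λ _ _ eq → eq) ⟩
  length (nonsingular a b ++ singular)            ≡⟨ List.length-++ (nonsingular a b) ⟩
  #nonsingular a b ℕ.+ length singular            ≤⟨ ℕ.+-monoʳ-≤ (#nonsingular a b) singular-bound ⟩
  #nonsingular a b ℕ.+ length (interval b)        ≡⟨ cong (#nonsingular a b ℕ.+_) (length-interval b) ⟩
  #nonsingular a b ℕ.+ suc (2 ℕ.* b)              ∎)
  where
  open ℕ.≤-Reasoning
  identity : ∀ a b → 2 ℕ.* a ℕ.+ (4 ℕ.* (a ℕ.* b) ℕ.+ suc (2 ℕ.* b)) ≡ suc (2 ℕ.* a) ℕ.* suc (2 ℕ.* b)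
  identity = solve-∀
  singular? : ∀ C → Dec (disc C ≡ 0ℤ)
  singular? C = disc C ℤ.≟ 0ℤ
  singular = filter singular? (box a b)
  split : ∀ {C} → C ∈ box a b → C ∈ nonsingular a b ++ singular
  split {C} C∈ = [ (λ s → ∈.∈-++⁺ʳ (nonsingular a b) (∈.∈-filter⁺ singular? C∈ s)) ,
                   (λ ns → ∈.∈-++⁺ˡ (∈.∈-filter⁺ ℰ̃? C∈ ns)) ]′ (toSum (singular? C))
  singular-bound : length singular ℕ.≤ length (interval b)
  singular-bound = length-injective Curve.B (Unique.filter⁺ singular? (box-unique a b))
    (λ C∈ → ∈-interval⁺ _ (proj₂ (∈-box⁻ a b (proj₁ (∈.∈-filter⁻ singular? C∈)))))
    (λ {C} {C′} C∈ C′∈ B≡ → determined C C′ B≡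
      (proj₂ (∈.∈-filter⁻ singular? {xs = box a b} C∈)) (proj₂ (∈.∈-filter⁻ singular? {xs = box a b} C′∈)))
    where
    determined : ∀ C C′ → Curve.B C ≡ Curve.B C′ → disc C ≡ 0ℤ → disc C′ ≡ 0ℤ → C ≡ C′
    determined (E A B) (E A′ _) refl disc≡0 disc′≡0 =
      cong (λ X → E X B) (disc-injectiveˡ A A′ B (trans disc≡0 (sym disc′≡0)))

-- The origin is in the box and singular, which removes the 1 from (2a + 1)(2b + 1). The bound is
-- then 0 for a = b = 0, as the base case of the induction requires.
#nonsingular-upper : ∀ a b → #nonsingular a b ℕ.≤ 4 ℕ.* (a ℕ.* b) ℕ.+ 2 ℕ.* (a ℕ.+ b)
#nonsingular-upper a b = ℕ.≤-pred (begin
  suc (#nonsingular a b)                             ≤⟨ length-injective (λ C → C) (origin∉ ∷ Unique.filter⁺ ℰ̃? (box-unique a b)) ∈-box (λ _ _ eq → eq) ⟩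
  length (box a b)                                   ≡⟨ length-box a b ⟩
  suc (2 ℕ.* a) ℕ.* suc (2 ℕ.* b)                    ≡⟨ identity a b ⟩
  suc (4 ℕ.* (a ℕ.* b) ℕ.+ 2 ℕ.* (a ℕ.+ b))          ∎)
  where
  open ℕ.≤-Reasoning
  identity : ∀ a b → suc (2 ℕ.* a) ℕ.* suc (2 ℕ.* b) ≡ suc (4 ℕ.* (a ℕ.* b) ℕ.+ 2 ℕ.* (a ℕ.+ b))
  identity = solve-∀
  origin = E (+ 0) (+ 0)
  origin∉ : All (origin ≢_) (nonsingular a b)
  origin∉ = All.tabulate λ { C∈ refl → proj₂ (∈.∈-filter⁻ ℰ̃? {xs = box a b} C∈) refl }
  ∈-box : ∀ {C} → C ∈ origin ∷ nonsingular a b → C ∈ box a b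
  ∈-box (here refl) = ∈-box⁺ origin (z≤n , z≤n)
  ∈-box (there C∈)  = proj₁ (∈.∈-filter⁻ ℰ̃? C∈)

#minimal≤#nonsingular : ∀ a b → #minimal a b ℕ.≤ #nonsingular a b
#minimal≤#nonsingular a b = length-injective (λ C → C) (Unique.filter⁺ ℰ? (box-unique a b))
  (λ C∈ → let C∈box , ℰC = ∈.∈-filter⁻ ℰ? {xs = box a b} C∈ in ∈.∈-filter⁺ ℰ̃? C∈box (proj₁ ℰC)) (λ _ _ eq → eq)

-- ⌊ a / (i + 1)ᵏ ⌋
opaque
  quotient : ℕ → ℕ → ℕ → ℕ
  quotient k i a = (a ℕ./ suc i ℕ.^ k) {{ℕ.m^n≢0 (suc i) k}}

  quotient-lower : ∀ k i a → suc i ℕ.^ k ℕ.* quotient k i a ℕ.≤ a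
  quotient-lower k i a = ℕ.≤-trans (ℕ.≤-reflexive (ℕ.*-comm (suc i ℕ.^ k) _)) (ℕ.m/n*n≤m a (suc i ℕ.^ k) {{ℕ.m^n≢0 (suc i) k}})

  quotient-upper : ∀ k i a → a ℕ.≤ suc i ℕ.^ k ℕ.* suc (quotient k i a)
  quotient-upper k i a = begin
    a                                  ≡⟨ ℕ.m≡m%n+[m/n]*n a n ⟩
    a ℕ.% n ℕ.+ quotient k i a ℕ.* n   ≤⟨ ℕ.+-monoˡ-≤ _ (ℕ.m%n≤n a n) ⟩
    suc (quotient k i a) ℕ.* n         ≡⟨ ℕ.*-comm _ n ⟩
    n ℕ.* suc (quotient k i a)         ∎
    where
    open ℕ.≤-Reasoning
    n : ℕ
    n = suc i ℕ.^ k
    instance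
      n≢0 : ℕ.NonZero n
      n≢0 = ℕ.m^n≢0 (suc i) k

  quotient-max : ∀ k i a x → suc i ℕ.^ k ℕ.* x ℕ.≤ a → x ℕ.≤ quotient k i a
  quotient-max k i a x nx≤a = subst (ℕ._≤ quotient k i a)
    (trans (cong (quotient k i) (ℕ.*-comm (suc i ℕ.^ k) x)) (ℕ.m*n/n≡m x (suc i ℕ.^ k) {{ℕ.m^n≢0 (suc i) k}}))
    (ℕ./-monoˡ-≤ (suc i ℕ.^ k) {{ℕ.m^n≢0 (suc i) k}} nx≤a)

  quotient-zero : ∀ k a → quotient k 0 a ≡ a
  quotient-zero k a = trans
    (ℕ./-congʳ {n = 1 ℕ.^ k} {o = 1} {m = a} {{ℕ.m^n≢0 1 k}} (ℕ.^-zeroˡ k)) (ℕ.n/1≡n a)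

scale-InBox⁺ : ∀ i {a b} C → InBox (quotient 4 i a) (quotient 6 i b) C → InBox a b (scale (suc i) C)
scale-InBox⁺ i {a} {b} (E A B) (A≤ , B≤) = bound 4 a A A≤ , bound 6 b B B≤
  where
  bound : ∀ k a X → ℤ.∣ X ∣ ℕ.≤ quotient k i a → ℤ.∣ + (suc i ℕ.^ k) ℤ.* X ∣ ℕ.≤ a
  bound k a X X≤ = subst (ℕ._≤ a) (sym (∣+∣-homo (suc i ℕ.^ k) X))
    (ℕ.≤-trans (ℕ.*-monoʳ-≤ (suc i ℕ.^ k) X≤) (quotient-lower k i a))

scale-InBox⁻ : ∀ i {a b} C → InBox a b (scale (suc i) C) → InBox (quotient 4 i a) (quotient 6 i b) C
scale-InBox⁻ i {a} {b} (E A B) (A≤ , B≤) = bound 4 a A A≤ , bound 6 b B B≤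
  where
  bound : ∀ k a X → ℤ.∣ + (suc i ℕ.^ k) ℤ.* X ∣ ℕ.≤ a → ℤ.∣ X ∣ ℕ.≤ quotient k i a
  bound k a X X≤ = quotient-max k i a ℤ.∣ X ∣ (subst (ℕ._≤ a) (∣+∣-homo (suc i ℕ.^ k) X) X≤)

-- Sorting the nonsingular curves by the scaling factor `suc i` of their minimal model

level levels : ℕ → ℕ → ℕ → List Curve
level a b i = map (scale (suc i)) (minimal (quotient 4 i a) (quotient 6 i b))
levels a b zero    = []
levels a b (suc N) = levels a b N ++ level a b N

∈-level⁻ : ∀ a b i {C} → C ∈ level a b i → ∃[ C′ ] ℰ C′ × InBox (quotient 4 i a) (quotient 6 i b) C′ × C ≡ scale (suc i) C′
∈-level⁻ a b i C∈ =
  let C′ , C′∈ , C≡ = ∈.∈-map⁻ (scale (suc i)) C∈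
      C′∈box , ℰC′  = ∈.∈-filter⁻ ℰ? {xs = box (quotient 4 i a) (quotient 6 i b)} C′∈
  in C′ , ℰC′ , ∈-box⁻ (quotient 4 i a) (quotient 6 i b) C′∈box , C≡

∈-levels⁺ : ∀ a b {i C} N → i ℕ.< N → C ∈ level a b i → C ∈ levels a b N
∈-levels⁺ a b (suc N) i<1+N C∈ with ℕ.m≤n⇒m<n∨m≡n (ℕ.≤-pred i<1+N)
... | inj₁ i<N  = ∈.∈-++⁺ˡ (∈-levels⁺ a b N i<N C∈)
... | inj₂ refl = ∈.∈-++⁺ʳ (levels a b N) C∈

∈-levels⁻ : ∀ a b {C} N → C ∈ levels a b N → ∃[ i ] i ℕ.< N × C ∈ level a b i
∈-levels⁻ a b (suc N) C∈ with ∈.∈-++⁻ (levels a b N) C∈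
... | inj₁ C∈levels = let i , i<N , C∈level = ∈-levels⁻ a b N C∈levels in i , ℕ.m≤n⇒m≤1+n i<N , C∈level
... | inj₂ C∈level  = N , ℕ.≤-refl , C∈level

level-disjoint : ∀ a b i j {C} → C ∈ level a b i → C ∈ level a b j → i ≡ j
level-disjoint a b i j C∈i C∈j =
  let C₁ , ℰC₁ , _ , C≡₁ = ∈-level⁻ a b i C∈i
      C₂ , ℰC₂ , _ , C≡₂ = ∈-level⁻ a b j C∈j
  in ℕ.suc-injective (scale-unique (suc i) (suc j) C₁ C₂ ℰC₁ ℰC₂ (trans (sym C≡₁) C≡₂))

levels-unique : ∀ a b N → Unique (levels a b N)
levels-unique a b zero    = []
levels-unique a b (suc N) = Unique.++⁺ (levels-unique a b N)
  (Unique.map⁺ (scale-injective (suc N) _ _) (Unique.filter⁺ ℰ? (box-unique _ _)))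
  λ (C∈levels , C∈level) → let i , i<N , C∈i = ∈-levels⁻ a b N C∈levels in
    ℕ.<⇒≢ i<N (level-disjoint a b i N C∈i C∈level)

scaling-bound : ∀ i {a b} C → ℰ̃ C → InBox a b (scale (suc i) C) → i ℕ.< a ℕ.⊔ b
scaling-bound i {a} {b} (E A B) ≢0 (A≤ , B≤) =
  [ (λ A≢0 → ℕ.≤-trans (bound 3 A {{A≢0}} A≤) (ℕ.m≤m⊔n a b)) ,
    (λ B≢0 → ℕ.≤-trans (bound 5 B {{B≢0}} B≤) (ℕ.m≤n⊔m a b)) ]′ (ℰ̃⇒nonzero A B ≢0)
  where
  bound : ∀ k X {a} .{{_ : ℕ.NonZero ℤ.∣ X ∣}} → ℤ.∣ + (suc i ℕ.^ suc k) ℤ.* X ∣ ℕ.≤ a → i ℕ.< a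
  bound k X {a} X≤ = ℕ.≤-trans (n≤n^1+k (suc i) k)
    (ℕ.≤-trans (ℕ.m≤m*n (suc i ℕ.^ suc k) ℤ.∣ X ∣) (subst (ℕ._≤ a) (∣+∣-homo (suc i ℕ.^ suc k) X) X≤))

-- Every nonsingular curve has a minimal model, and uniqueness of the scaling factor makes the
-- levels disjoint. By `scaling-bound` no level from `a ⊔ b` on contains a curve, so `N` may exceed
-- `a ⊔ b` at will. This lets one partial sum serve every box of the induction.
#levels : ∀ a b N → a ℕ.⊔ b ℕ.≤ N → length (levels a b N) ≡ #nonsingular a b
#levels a b N a⊔b≤N = length-≡ (levels-unique a b N) (Unique.filter⁺ ℰ̃? (box-unique a b)) ⊆-nonsingular ⊆-levels
  where
  ⊆-nonsingular : ∀ {C} → C ∈ levels a b N → C ∈ nonsingular a b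
  ⊆-nonsingular C∈ =
    let i , _ , C∈i             = ∈-levels⁻ a b N C∈
        C′ , ℰC′ , C′≤ , C≡     = ∈-level⁻ a b i C∈i
    in subst (_∈ nonsingular a b) (sym C≡)
         (∈.∈-filter⁺ ℰ̃? (∈-box⁺ (scale (suc i) C′) (scale-InBox⁺ i C′ C′≤)) (scale-ℰ̃⁺ (suc i) C′ (proj₁ ℰC′)))
  ⊆-levels : ∀ {C} → C ∈ nonsingular a b → C ∈ levels a b N
  ⊆-levels {C} C∈ = let C∈box , ℰ̃C = ∈.∈-filter⁻ ℰ̃? {xs = box a b} C∈ in go (∈-box⁻ a b C∈box) (minimal-model C ℰ̃C)
    where
    go : InBox a b C → (∃[ d ] ℕ.NonZero d × ∃[ C′ ] ℰ C′ × C ≡ scale d C′) → C ∈ levels a b N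
    go C≤ (suc i , _ , C′ , ℰC′ , C≡) =
      let scaled≤ = subst (InBox a b) C≡ C≤ in
      ∈-levels⁺ a b {i} N (ℕ.<-≤-trans (scaling-bound i C′ (proj₁ ℰC′) scaled≤) a⊔b≤N)
        (subst (_∈ level a b i) (sym C≡)
          (∈.∈-map⁺ (scale (suc i)) (∈.∈-filter⁺ ℰ? (∈-box⁺ C′ (scale-InBox⁻ i C′ scaled≤)) ℰC′)))

quotient-≤ : ∀ k i a → quotient k i a ℕ.≤ a
quotient-≤ k i a = ℕ.≤-trans (ℕ.m≤n*m (quotient k i a) (suc i ℕ.^ k) {{ℕ.m^n≢0 (suc i) k}}) (quotient-lower k i a)

quotient-< : ∀ k i a → quotient (suc k) (suc i) (suc a) ℕ.< suc a
quotient-< k i a = go (quotient (suc k) (suc i) (suc a)) (quotient-lower (suc k) (suc i) (suc a))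
  where
  go : ∀ x → suc (suc i) ℕ.^ suc k ℕ.* x ℕ.≤ suc a → x ℕ.< suc a
  go zero    _     = s≤s z≤n
  go x@(suc _) px≤a = ℕ.<-≤-trans
    (subst (x ℕ.<_) (ℕ.*-comm x _)
      (ℕ.m<m*n x (suc (suc i) ℕ.^ suc k) (ℕ.<-≤-trans (s≤s (s≤s z≤n)) (n≤n^1+k (suc (suc i)) k)))) px≤a

-- Rational arithmetic

≤⇒0≤- : ∀ {p q} → p ℚ.≤ q → 0ℚ ℚ.≤ q ℚ.- p
≤⇒0≤- {p} {q} p≤q = subst (ℚ._≤ q ℚ.- p) (ℚ.+-inverseʳ p) (ℚ.+-monoˡ-≤ (ℚ.- p) p≤q)

-- Linear inequalities are proved by writing the difference of the two sides as a
-- combination of nonnegative terms.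
by-difference : ∀ {p q} d → 0ℚ ℚ.≤ d → d ≡ q ℚ.- p → p ℚ.≤ q
by-difference {p} {q} d 0≤d d≡ = begin
  p               ≡⟨ ℚ.+-identityʳ p ⟨
  p ℚ.+ 0ℚ        ≤⟨ ℚ.+-monoʳ-≤ p 0≤d ⟩
  p ℚ.+ d         ≡⟨ cong (p ℚ.+_) d≡ ⟩
  p ℚ.+ (q ℚ.- p) ≡⟨ solve 2 (λ p q → p :+ (q :- p) := q) refl p q ⟩
  q               ∎
  where
  open ℚ.≤-Reasoning
  open ℚ-Solver.+-*-Solver

0≤+ : ∀ {p q} → 0ℚ ℚ.≤ p → 0ℚ ℚ.≤ q → 0ℚ ℚ.≤ p ℚ.+ q
0≤+ = ℚ.+-mono-≤

0≤* : ∀ {p q} → 0ℚ ℚ.≤ p → 0ℚ ℚ.≤ q → 0ℚ ℚ.≤ p ℚ.* q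
0≤* {p} {q} 0≤p 0≤q = ℚ.nonNegative⁻¹ (p ℚ.* q)
  {{ℚ.nonNeg*nonNeg⇒nonNeg p {{ℚ.nonNegative 0≤p}} q {{ℚ.nonNegative 0≤q}}}}

opaque
  -- Opaque, so that `ι n` is an atom for the ring solver instead of a fraction to be normalised.
  -- The equations of this block are the only access to its values.
  ι : ℕ → ℚ
  ι n = + n ℚ./ 1

  private
    toℚᵘ-ι : ∀ n → ℚ.toℚᵘ (ι n) ℚᵘ.≃ + n ℚᵘ./ 1
    toℚᵘ-ι n = ℚ.toℚᵘ-fromℚᵘ (+ n ℚᵘ./ 1)

  ι-def : ∀ n → ι n ≡ + n ℚ./ 1
  ι-def n = refl

  ι-0 : ι 0 ≡ 0ℚ
  ι-0 = refl

  ι-1 : ι 1 ≡ 1ℚ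
  ι-1 = refl

  ι-2 : ι 2 ≡ 1ℚ ℚ.+ 1ℚ
  ι-2 = refl

  ι-4 : ι 4 ≡ + 4 ℚ./ 1
  ι-4 = refl

  ι-+ : ∀ m n → ι (m ℕ.+ n) ≡ ι m ℚ.+ ι n
  ι-+ m n = ℚ.toℚᵘ-injective (ℚᵘ.≃-trans (toℚᵘ-ι (m ℕ.+ n))
    (ℚᵘ.≃-trans {j = (+ m ℚᵘ./ 1) ℚᵘ.+ (+ n ℚᵘ./ 1)} (ℚᵘ.*≡* (identity (+ m) (+ n)))
      (ℚᵘ.≃-sym (ℚᵘ.≃-trans (ℚ.toℚᵘ-homo-+ (ι m) (ι n)) (ℚᵘ.+-cong (toℚᵘ-ι m) (toℚᵘ-ι n))))))
    where
    open ℤ-Solver.+-*-Solver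
    identity : ∀ x y → (x ℤ.+ y) ℤ.* + 1 ≡ (x ℤ.* + 1 ℤ.+ y ℤ.* + 1) ℤ.* + 1
    identity = solve 2 (λ x y → (x :+ y) :* con (+ 1) := (x :* con (+ 1) :+ y :* con (+ 1)) :* con (+ 1)) refl

  ι-* : ∀ m n → ι (m ℕ.* n) ≡ ι m ℚ.* ι n
  ι-* m n = ℚ.toℚᵘ-injective (ℚᵘ.≃-trans (toℚᵘ-ι (m ℕ.* n))
    (ℚᵘ.≃-trans {j = (+ m ℚᵘ./ 1) ℚᵘ.* (+ n ℚᵘ./ 1)} (ℚᵘ.*≡* (cong (ℤ._* + 1) (ℤ.pos-* m n)))
      (ℚᵘ.≃-sym (ℚᵘ.≃-trans (ℚ.toℚᵘ-homo-* (ι m) (ι n)) (ℚᵘ.*-cong (toℚᵘ-ι m) (toℚᵘ-ι n))))))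

  ι-mono : ∀ {m n} → m ℕ.≤ n → ι m ℚ.≤ ι n
  ι-mono {m} {n} m≤n = ℚ.toℚᵘ-cancel-≤
    (ℚᵘ.≤-respʳ-≃ (ℚᵘ.≃-sym (toℚᵘ-ι n)) (ℚᵘ.≤-respˡ-≃ (ℚᵘ.≃-sym (toℚᵘ-ι m))
      (ℚᵘ.*≤* (ℤ.*-monoʳ-≤-nonNeg (+ 1) (ℤ.+≤+ m≤n)))))

  fraction-* : ∀ n m .{{_ : ℕ.NonZero m}} → (+ n ℚ./ m) ℚ.* ι m ≡ ι n
  fraction-* n m@(suc _) = ℚ.toℚᵘ-injective
    (ℚᵘ.≃-trans (ℚ.toℚᵘ-homo-* (+ n ℚ./ m) (ι m))
      (ℚᵘ.≃-trans (ℚᵘ.*-cong (ℚ.toℚᵘ-fromℚᵘ (+ n ℚᵘ./ m)) (toℚᵘ-ι m))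
        (ℚᵘ.≃-trans {j = + n ℚᵘ./ 1} (ℚᵘ.*≡* identity) (ℚᵘ.≃-sym (toℚᵘ-ι n)))))
    where
    identity : (+ n ℤ.* + m) ℤ.* + 1 ≡ + n ℤ.* + (m ℕ.* 1)
    identity = trans (ℤ.*-identityʳ _) (cong (λ k → + n ℤ.* + k) (sym (ℕ.*-identityʳ m)))

0≤ι : ∀ n → 0ℚ ℚ.≤ ι n
0≤ι n = subst (ℚ._≤ ι n) ι-0 (ι-mono z≤n)

0<ι : ∀ n .{{_ : ℕ.NonZero n}} → 0ℚ ℚ.< ι n
0<ι n@(suc _) = ℚ.<-≤-trans (ℚ.positive⁻¹ 1ℚ) (subst (ℚ._≤ ι n) ι-1 (ι-mono (s≤s z≤n)))

-- The weights (i + 1)⁻ᵏ and partial sums of ζ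

weight : ℕ → ℕ → ℚ
weight k i = 1/ℕ (suc i ℕ.^ k) {{ℕ.m^n≢0 (suc i) k}}

0≤weight : ∀ k i → 0ℚ ℚ.≤ weight k i
0≤weight k i = ℚ.<⇒≤ (0<1/ℕ (suc i ℕ.^ k) {{ℕ.m^n≢0 (suc i) k}})

1/ℕ-inverse : ∀ n .{{_ : ℕ.NonZero n}} → 1/ℕ n ℚ.* ι n ≡ 1ℚ
1/ℕ-inverse n = trans (fraction-* 1 n) ι-1

1/ℕ-* : ∀ m n .{{_ : ℕ.NonZero m}} .{{_ : ℕ.NonZero n}} .{{_ : ℕ.NonZero (m ℕ.* n)}} → 1/ℕ (m ℕ.* n) ≡ 1/ℕ m ℚ.* 1/ℕ n
1/ℕ-* m n = begin
  p                                     ≡⟨ ℚ.*-identityʳ p ⟨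
  p ℚ.* 1ℚ                              ≡⟨ cong (p ℚ.*_) (cong₂ ℚ._*_ (1/ℕ-inverse m) (1/ℕ-inverse n)) ⟨
  p ℚ.* ((q ℚ.* ι m) ℚ.* (r ℚ.* ι n))   ≡⟨ solve 5 (λ p q r m n → p :* ((q :* m) :* (r :* n)) := (p :* (m :* n)) :* (q :* r)) refl p q r (ι m) (ι n) ⟩
  p ℚ.* (ι m ℚ.* ι n) ℚ.* (q ℚ.* r)     ≡⟨ cong (λ x → p ℚ.* x ℚ.* (q ℚ.* r)) (ι-* m n) ⟨
  p ℚ.* ι (m ℕ.* n) ℚ.* (q ℚ.* r)       ≡⟨ cong (ℚ._* (q ℚ.* r)) (1/ℕ-inverse (m ℕ.* n)) ⟩
  1ℚ ℚ.* (q ℚ.* r)                      ≡⟨ ℚ.*-identityˡ (q ℚ.* r) ⟩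
  q ℚ.* r                               ∎
  where
  open ≡-Reasoning
  open ℚ-Solver.+-*-Solver
  p = 1/ℕ (m ℕ.* n)
  q = 1/ℕ m
  r = 1/ℕ n

1/ℕ-cong : ∀ {m n} .{{_ : ℕ.NonZero m}} .{{_ : ℕ.NonZero n}} → m ≡ n → 1/ℕ m ≡ 1/ℕ n
1/ℕ-cong refl = refl

weight-+ : ∀ j k i → weight (j ℕ.+ k) i ≡ weight j i ℚ.* weight k i
weight-+ j k i = trans
  (1/ℕ-cong {{ℕ.m^n≢0 (suc i) (j ℕ.+ k)}} {{nz}} (ℕ.^-distribˡ-+-* (suc i) j k))
  (1/ℕ-* (suc i ℕ.^ j) (suc i ℕ.^ k) {{ℕ.m^n≢0 (suc i) j}} {{ℕ.m^n≢0 (suc i) k}} {{nz}})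
  where nz = ℕ.m*n≢0 (suc i ℕ.^ j) (suc i ℕ.^ k) {{ℕ.m^n≢0 (suc i) j}} {{ℕ.m^n≢0 (suc i) k}}

weight-antimono : ∀ {j k} i → j ℕ.≤ k → weight k i ℚ.≤ weight j i
weight-antimono {j} {k} i j≤k = 1/ℕ-antimono (suc i ℕ.^ j) (suc i ℕ.^ k) {{ℕ.m^n≢0 (suc i) j}} {{ℕ.m^n≢0 (suc i) k}}
  (ℕ.^-monoʳ-≤ (suc i) j≤k)

-- ι a * weight k i = a / (i + 1)ᵏ
quotient-≤-weight : ∀ k i a → ι (quotient k i a) ℚ.≤ ι a ℚ.* weight k i
quotient-≤-weight k i a = begin
  x                          ≡⟨ ℚ.*-identityˡ x ⟨
  1ℚ ℚ.* x                   ≡⟨ cong (ℚ._* x) (1/ℕ-inverse n) ⟨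
  w ℚ.* ι n ℚ.* x            ≡⟨ ℚ.*-assoc w (ι n) x ⟩
  w ℚ.* (ι n ℚ.* x)          ≡⟨ cong (w ℚ.*_) (ι-* n (quotient k i a)) ⟨
  w ℚ.* ι (n ℕ.* quotient k i a)
    ≤⟨ ℚ.*-monoˡ-≤-nonNeg w {{ℚ.nonNegative (0≤weight k i)}} (ι-mono (quotient-lower k i a)) ⟩
  w ℚ.* ι a                  ≡⟨ ℚ.*-comm w (ι a) ⟩
  ι a ℚ.* w                  ∎
  where
  open ℚ.≤-Reasoning
  n = suc i ℕ.^ k
  instance
    n≢0 : ℕ.NonZero n
    n≢0 = ℕ.m^n≢0 (suc i) k
  x = ι (quotient k i a)
  w = weight k i

weight-≤-quotient : ∀ k i a → ι a ℚ.* weight k i ℚ.≤ ι (quotient k i a) ℚ.+ 1ℚ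
weight-≤-quotient k i a = begin
  ι a ℚ.* w                  ≡⟨ ℚ.*-comm (ι a) w ⟩
  w ℚ.* ι a
    ≤⟨ ℚ.*-monoˡ-≤-nonNeg w {{ℚ.nonNegative (0≤weight k i)}} (ι-mono (quotient-upper k i a)) ⟩
  w ℚ.* ι (n ℕ.* suc q)      ≡⟨ cong (w ℚ.*_) (ι-* n (suc q)) ⟩
  w ℚ.* (ι n ℚ.* ι (suc q))  ≡⟨ ℚ.*-assoc w (ι n) _ ⟨
  w ℚ.* ι n ℚ.* ι (suc q)    ≡⟨ cong (ℚ._* ι (suc q)) (1/ℕ-inverse n) ⟩
  1ℚ ℚ.* ι (suc q)           ≡⟨ ℚ.*-identityˡ _ ⟩
  ι (1 ℕ.+ q)                ≡⟨ ι-+ 1 q ⟩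
  ι 1 ℚ.+ ι q                ≡⟨ ℚ.+-comm (ι 1) (ι q) ⟩
  ι q ℚ.+ ι 1                ≡⟨ cong (ι q ℚ.+_) ι-1 ⟩
  ι q ℚ.+ 1ℚ                 ∎
  where
  open ℚ.≤-Reasoning
  n = suc i ℕ.^ k
  instance
    n≢0 : ℕ.NonZero n
    n≢0 = ℕ.m^n≢0 (suc i) k
  q = quotient k i a
  w = weight k i

4ℚ 7ℚ 12ℚ 14ℚ 16ℚ : ℚ
4ℚ  = + 4 ℚ./ 1
7ℚ  = + 7 ℚ./ 1
12ℚ = + 12 ℚ./ 1
14ℚ = + 14 ℚ./ 1
16ℚ = + 16 ℚ./ 1

0≤4 : 0ℚ ℚ.≤ 4ℚ
0≤4 = ℚ.nonNegative⁻¹ 4ℚ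

0≤12 : 0ℚ ℚ.≤ 12ℚ
0≤12 = ℚ.nonNegative⁻¹ 12ℚ

weight-zero : ∀ k → weight k 0 ≡ 1ℚ
weight-zero k = 1/ℕ-cong {1 ℕ.^ k} {1} {{ℕ.m^n≢0 1 k}} (ℕ.^-zeroˡ k)

-- Since (n + 2)² ≥ 2 (n + 1), the term 1/(n + 2)³ is at most half of 1/((n + 1)(n + 2)), which
-- telescopes. That half is what makes the error of the induction contract.
weight-telescope : ∀ k n → 3 ℕ.≤ k → weight k (suc n) ℚ.+ ½ ℚ.* 1/ℕ (suc (suc n)) ℚ.≤ ½ ℚ.* 1/ℕ (suc n)
weight-telescope k n 3≤k = begin
  weight k (suc n) ℚ.+ ½ ℚ.* v              ≤⟨ ℚ.+-monoˡ-≤ (½ ℚ.* v) (ℚ.≤-trans (weight-antimono (suc n) 3≤k) cube) ⟩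
  ½ ℚ.* 1/ℕ (suc n ℕ.* suc (suc n)) ℚ.+ ½ ℚ.* v ≡⟨ ℚ.*-distribˡ-+ ½ (1/ℕ (suc n ℕ.* suc (suc n))) v ⟨
  ½ ℚ.* (1/ℕ (suc n ℕ.* suc (suc n)) ℚ.+ v) ≡⟨ cong (½ ℚ.*_) (1/ℕ-telescope n) ⟩
  ½ ℚ.* 1/ℕ (suc n)                         ∎
  where
  open ℚ.≤-Reasoning
  v = 1/ℕ (suc (suc n))
  identity : ∀ n → suc (suc n) ℕ.* (suc (suc n) ℕ.* (suc (suc n) ℕ.* 1)) ≡
                   2 ℕ.* (suc n ℕ.* suc (suc n)) ℕ.+ suc (suc n) ℕ.* (n ℕ.* n ℕ.+ 2 ℕ.* n ℕ.+ 2)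
  identity = solve-∀
  cube : weight 3 (suc n) ℚ.≤ ½ ℚ.* 1/ℕ (suc n ℕ.* suc (suc n))
  cube = ℚ.≤-trans
    (1/ℕ-antimono (2 ℕ.* (suc n ℕ.* suc (suc n))) (suc (suc n) ℕ.^ 3) {{_}} {{ℕ.m^n≢0 (suc (suc n)) 3}}
      (subst (2 ℕ.* (suc n ℕ.* suc (suc n)) ℕ.≤_) (sym (identity n)) (ℕ.m≤m+n _ _)))
    (ℚ.≤-reflexive (1/ℕ-* 2 (suc n ℕ.* suc (suc n))))

ζ-partial-upper : ∀ k n → 3 ℕ.≤ k → ζ-partial k (suc n) ℚ.≤ 1ℚ ℚ.+ ½
ζ-partial-upper k n 3≤k = ℚ.≤-trans
  (ℚ.≤-trans (ℚ.≤-reflexive (sym (ℚ.+-identityʳ _)))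
    (ℚ.+-monoʳ-≤ (ζ-partial k (suc n)) (0≤* (ℚ.nonNegative⁻¹ ½) (ℚ.<⇒≤ (0<1/ℕ (suc n))))))
  (stronger n)
  where
  open ℚ.≤-Reasoning
  -- The bound for the remaining tail is carried along so that each step telescopes; for n = 0 it
  -- holds with equality.
  stronger : ∀ n → ζ-partial k (suc n) ℚ.+ ½ ℚ.* 1/ℕ (suc n) ℚ.≤ 1ℚ ℚ.+ ½
  stronger zero    = ℚ.≤-reflexive (cong (λ w → 0ℚ ℚ.+ w ℚ.+ ½ ℚ.* 1/ℕ 1) (weight-zero k))
  stronger (suc n) = begin
    ζ-partial k (suc n) ℚ.+ weight k (suc n) ℚ.+ ½ ℚ.* 1/ℕ (suc (suc n))   ≡⟨ ℚ.+-assoc (ζ-partial k (suc n)) _ _ ⟩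
    ζ-partial k (suc n) ℚ.+ (weight k (suc n) ℚ.+ ½ ℚ.* 1/ℕ (suc (suc n))) ≤⟨ ℚ.+-monoʳ-≤ (ζ-partial k (suc n)) (weight-telescope k n 3≤k) ⟩
    ζ-partial k (suc n) ℚ.+ ½ ℚ.* 1/ℕ (suc n)                             ≤⟨ stronger n ⟩
    1ℚ ℚ.+ ½                                                              ∎

ζ-partial-1 : ∀ k → ζ-partial k 1 ≡ 1ℚ
ζ-partial-1 k = trans (ℚ.+-identityˡ (weight k 0)) (weight-zero k)

ζ-partial-lower : ∀ k n → 1ℚ ℚ.≤ ζ-partial k (suc n)
ζ-partial-lower k zero    = ℚ.≤-reflexive (sym (ζ-partial-1 k))
ζ-partial-lower k (suc n) = ℚ.≤-trans (ζ-partial-lower k n)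
  (ℚ.≤-trans (ℚ.≤-reflexive (sym (ℚ.+-identityʳ _)))
    (ℚ.+-monoʳ-≤ (ζ-partial k (suc n)) (0≤weight k (suc n))))

open ℚ-Solver.+-*-Solver using (solve; _:+_; _:*_; :-_; _:-_; _:=_; con)

-- Here ξ = a/d⁴ and η = b/d⁶, while x and y are their integer parts. An upper bound increasing in x
-- and y survives the removal of the floors at no cost.
shrink-upper : ∀ {t x y ξ η} → 0ℚ ℚ.≤ x → x ℚ.≤ ξ → y ℚ.≤ η → 0ℚ ℚ.≤ η →
               t ℚ.≤ 4ℚ ℚ.* (x ℚ.* y) ℚ.+ 12ℚ ℚ.* (x ℚ.+ y) →
               t ℚ.≤ 4ℚ ℚ.* (ξ ℚ.* η) ℚ.+ 12ℚ ℚ.* (ξ ℚ.+ η)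
shrink-upper {t} {x} {y} {ξ} {η} 0≤x x≤ξ y≤η 0≤η t≤ =
  by-difference ((4ℚ ℚ.* (x ℚ.* y) ℚ.+ 12ℚ ℚ.* (x ℚ.+ y) ℚ.- t) ℚ.+ (4ℚ ℚ.* ((ξ ℚ.- x) ℚ.* η ℚ.+ x ℚ.* (η ℚ.- y)) ℚ.+ 12ℚ ℚ.* ((ξ ℚ.- x) ℚ.+ (η ℚ.- y))))
    (0≤+ (≤⇒0≤- t≤) (0≤+ (0≤* 0≤4 (0≤+ (0≤* (≤⇒0≤- x≤ξ) 0≤η) (0≤* 0≤x (≤⇒0≤- y≤η)))) (0≤* 0≤12 (0≤+ (≤⇒0≤- x≤ξ) (≤⇒0≤- y≤η)))))
    (solve 5 (λ t x y ξ η →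
      (con 4ℚ :* (x :* y) :+ con 12ℚ :* (x :+ y) :- t) :+ (con 4ℚ :* ((ξ :- x) :* η :+ x :* (η :- y)) :+ con 12ℚ :* ((ξ :- x) :+ (η :- y))) :=
      (con 4ℚ :* (ξ :* η) :+ con 12ℚ :* (ξ :+ η)) :- t) refl t x y ξ η)

-- In this direction the floors cost something: ξη - xy = (ξ - x) η + x (η - y) ≤ η + ξ. Times 4,
-- this raises the constant from 12 to 16.
shrink-lower : ∀ {t x y ξ η} → 0ℚ ℚ.≤ x → x ℚ.≤ ξ → y ℚ.≤ η → 0ℚ ℚ.≤ η → ξ ℚ.≤ x ℚ.+ 1ℚ → η ℚ.≤ y ℚ.+ 1ℚ →
               4ℚ ℚ.* (x ℚ.* y) ℚ.≤ t ℚ.+ 12ℚ ℚ.* (x ℚ.+ y) →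
               4ℚ ℚ.* (ξ ℚ.* η) ℚ.≤ t ℚ.+ 16ℚ ℚ.* (ξ ℚ.+ η)
shrink-lower {t} {x} {y} {ξ} {η} 0≤x x≤ξ y≤η 0≤η ξ≤ η≤ ≤t =
  by-difference (((t ℚ.+ 12ℚ ℚ.* (x ℚ.+ y)) ℚ.- 4ℚ ℚ.* (x ℚ.* y)) ℚ.+ (12ℚ ℚ.* ((ξ ℚ.- x) ℚ.+ (η ℚ.- y)) ℚ.+ 4ℚ ℚ.* (((x ℚ.+ 1ℚ) ℚ.- ξ) ℚ.* η ℚ.+ x ℚ.* ((y ℚ.+ 1ℚ) ℚ.- η) ℚ.+ (ξ ℚ.- x))))
    (0≤+ (≤⇒0≤- ≤t) (0≤+ (0≤* 0≤12 (0≤+ (≤⇒0≤- x≤ξ) (≤⇒0≤- y≤η)))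
      (0≤* 0≤4 (0≤+ (0≤+ (0≤* (≤⇒0≤- ξ≤) 0≤η) (0≤* 0≤x (≤⇒0≤- η≤))) (≤⇒0≤- x≤ξ)))))
    (solve 5 (λ t x y ξ η →
      ((t :+ con 12ℚ :* (x :+ y)) :- con 4ℚ :* (x :* y)) :+ (con 12ℚ :* ((ξ :- x) :+ (η :- y)) :+ con 4ℚ :* (((x :+ con 1ℚ) :- ξ) :* η :+ x :* ((y :+ con 1ℚ) :- η) :+ (ξ :- x))) :=
      (t :+ con 16ℚ :* (ξ :+ η)) :- con 4ℚ :* (ξ :* η)) refl t x y ξ η)

combined-weight : ∀ {α β u v} → 0ℚ ℚ.≤ β → v ℚ.≤ u → α ℚ.* u ℚ.+ β ℚ.* v ℚ.≤ (α ℚ.+ β) ℚ.* u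
combined-weight {α} {β} {u} {v} 0≤β v≤u = by-difference (β ℚ.* (u ℚ.- v)) (0≤* 0≤β (≤⇒0≤- v≤u))
  (solve 4 (λ α β u v → β :* (u :- v) := (α :+ β) :* u :- (α :* u :+ β :* v)) refl α β u v)

-- The counting estimate

#level : ∀ a b i → length (level a b i) ≡ #minimal (quotient 4 i a) (quotient 6 i b)
#level a b i = List.length-map (scale (suc i)) (minimal (quotient 4 i a) (quotient 6 i b))

module _ (s : ℚ) where

  record Estimate (a b : ℕ) : Set where
    field
      upper : ι (#minimal a b) ℚ.* s ℚ.≤ 4ℚ ℚ.* (ι a ℚ.* ι b) ℚ.+ 12ℚ ℚ.* (ι a ℚ.+ ι b)
      lower : 4ℚ ℚ.* (ι a ℚ.* ι b) ℚ.≤ ι (#minimal a b) ℚ.* s ℚ.+ 12ℚ ℚ.* (ι a ℚ.+ ι b)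

  module _ (a b : ℕ) where

    private
      c g : ℚ
      c = 4ℚ ℚ.* (ι a ℚ.* ι b)
      g = ι a ℚ.+ ι b

    0≤weighted : ∀ k i n → 0ℚ ℚ.≤ ι n ℚ.* weight k i
    0≤weighted k i n = 0≤* (0≤ι n) (0≤weight k i)

    weighted-product : ∀ i → 4ℚ ℚ.* ((ι a ℚ.* weight 4 i) ℚ.* (ι b ℚ.* weight 6 i)) ≡ c ℚ.* weight 10 i
    weighted-product i = trans
      (solve 5 (λ k α β u v → k :* ((α :* u) :* (β :* v)) := k :* (α :* β) :* (u :* v)) refl 4ℚ (ι a) (ι b) (weight 4 i) (weight 6 i))
      (cong (c ℚ.*_) (sym (weight-+ 4 6 i)))

    -- The part of the error coming from `b` decays like d⁻⁶. It is weakened to d⁻⁴, so that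
    -- `ζ-partial 4` alone controls the total error.
    weighted-sum : ∀ k i → 0ℚ ℚ.≤ k → k ℚ.* (ι a ℚ.* weight 4 i ℚ.+ ι b ℚ.* weight 6 i) ℚ.≤ k ℚ.* g ℚ.* weight 4 i
    weighted-sum k i 0≤k = ℚ.≤-trans
      (ℚ.*-monoˡ-≤-nonNeg k {{ℚ.nonNegative 0≤k}} (combined-weight {ι a} {ι b} (0≤ι b) (weight-antimono i (ℕ.m≤m+n 4 2))))
      (ℚ.≤-reflexive (sym (ℚ.*-assoc k g (weight 4 i))))

    level-upper : ∀ i → Estimate (quotient 4 i a) (quotient 6 i b) →
                  ι (length (level a b i)) ℚ.* s ℚ.≤ c ℚ.* weight 10 i ℚ.+ 12ℚ ℚ.* g ℚ.* weight 4 i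
    level-upper i e = begin
      ι (length (level a b i)) ℚ.* s ≡⟨ cong (λ n → ι n ℚ.* s) (#level a b i) ⟩
      ι (#minimal (quotient 4 i a) (quotient 6 i b)) ℚ.* s
        ≤⟨ shrink-upper {t = ι (#minimal (quotient 4 i a) (quotient 6 i b)) ℚ.* s} (0≤ι (quotient 4 i a)) (quotient-≤-weight 4 i a) (quotient-≤-weight 6 i b) (0≤weighted 6 i b) (Estimate.upper e) ⟩
      4ℚ ℚ.* ((ι a ℚ.* weight 4 i) ℚ.* (ι b ℚ.* weight 6 i)) ℚ.+ 12ℚ ℚ.* (ι a ℚ.* weight 4 i ℚ.+ ι b ℚ.* weight 6 i)
        ≤⟨ ℚ.+-mono-≤ (ℚ.≤-reflexive (weighted-product i)) (weighted-sum 12ℚ i 0≤12) ⟩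
      c ℚ.* weight 10 i ℚ.+ 12ℚ ℚ.* g ℚ.* weight 4 i ∎
      where open ℚ.≤-Reasoning

    level-lower : ∀ i → Estimate (quotient 4 i a) (quotient 6 i b) →
                  c ℚ.* weight 10 i ℚ.≤ ι (length (level a b i)) ℚ.* s ℚ.+ 16ℚ ℚ.* g ℚ.* weight 4 i
    level-lower i e = begin
      c ℚ.* weight 10 i ≡⟨ weighted-product i ⟨
      4ℚ ℚ.* ((ι a ℚ.* weight 4 i) ℚ.* (ι b ℚ.* weight 6 i))
        ≤⟨ shrink-lower {t = ι (#minimal (quotient 4 i a) (quotient 6 i b)) ℚ.* s} (0≤ι (quotient 4 i a)) (quotient-≤-weight 4 i a) (quotient-≤-weight 6 i b) (0≤weighted 6 i b)
             (weight-≤-quotient 4 i a) (weight-≤-quotient 6 i b) (Estimate.lower e) ⟩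
      ι (#minimal (quotient 4 i a) (quotient 6 i b)) ℚ.* s ℚ.+ 16ℚ ℚ.* (ι a ℚ.* weight 4 i ℚ.+ ι b ℚ.* weight 6 i)
        ≤⟨ ℚ.+-mono-≤ (ℚ.≤-reflexive (cong (λ n → ι n ℚ.* s) (sym (#level a b i)))) (weighted-sum 16ℚ i (ℚ.nonNegative⁻¹ 16ℚ)) ⟩
      ι (length (level a b i)) ℚ.* s ℚ.+ 16ℚ ℚ.* g ℚ.* weight 4 i ∎
      where open ℚ.≤-Reasoning

    levels-zero : length (levels a b 1) ≡ #minimal a b
    levels-zero = trans (#level a b 0) (cong₂ #minimal (quotient-zero 4 a) (quotient-zero 6 b))

    levels-suc : ∀ M → ι (length (levels a b (suc M))) ≡ ι (length (levels a b M)) ℚ.+ ι (length (level a b M))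
    levels-suc M = trans (cong ι (List.length-++ (levels a b M))) (ι-+ (length (levels a b M)) (length (level a b M)))

    module _ (ih : ∀ i → Estimate (quotient 4 (suc i) a) (quotient 6 (suc i) b)) where

      -- The sum of `level-upper` over 1 ≤ i ≤ M. Level 0 contributes `#minimal a b` itself, and the
      -- terms for i = 0 in the two partial sums, both 1, are balanced by `c` and `12ℚ * g` on the
      -- left instead of being subtracted.
      levels-upper : ∀ M → ι (length (levels a b (suc M))) ℚ.* s ℚ.+ c ℚ.+ 12ℚ ℚ.* g ℚ.≤
                           ι (#minimal a b) ℚ.* s ℚ.+ c ℚ.* ζ-partial 10 (suc M) ℚ.+ 12ℚ ℚ.* g ℚ.* ζ-partial 4 (suc M)
      levels-upper zero = ℚ.≤-reflexive (begin
        ι (length (levels a b 1)) ℚ.* s ℚ.+ c ℚ.+ 12ℚ ℚ.* g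
          ≡⟨ cong₂ (λ n x → ι n ℚ.* s ℚ.+ x ℚ.+ 12ℚ ℚ.* g) levels-zero (sym (ℚ.*-identityʳ c)) ⟩
        ι (#minimal a b) ℚ.* s ℚ.+ c ℚ.* 1ℚ ℚ.+ 12ℚ ℚ.* g
          ≡⟨ cong (λ x → ι (#minimal a b) ℚ.* s ℚ.+ c ℚ.* 1ℚ ℚ.+ x) (sym (ℚ.*-identityʳ (12ℚ ℚ.* g))) ⟩
        ι (#minimal a b) ℚ.* s ℚ.+ c ℚ.* 1ℚ ℚ.+ 12ℚ ℚ.* g ℚ.* 1ℚ
          ≡⟨ cong₂ (λ x y → ι (#minimal a b) ℚ.* s ℚ.+ c ℚ.* x ℚ.+ 12ℚ ℚ.* g ℚ.* y) (ζ-partial-1 10) (ζ-partial-1 4) ⟨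
        ι (#minimal a b) ℚ.* s ℚ.+ c ℚ.* ζ-partial 10 1 ℚ.+ 12ℚ ℚ.* g ℚ.* ζ-partial 4 1 ∎)
        where open ≡-Reasoning
      levels-upper (suc M) = begin
        ι (length (levels a b (suc (suc M)))) ℚ.* s ℚ.+ c ℚ.+ 12ℚ ℚ.* g
          ≡⟨ cong (λ x → x ℚ.* s ℚ.+ c ℚ.+ 12ℚ ℚ.* g) (levels-suc (suc M)) ⟩
        (L ℚ.+ l) ℚ.* s ℚ.+ c ℚ.+ 12ℚ ℚ.* g
          ≡⟨ solve 5 (λ L l s c h → (L :+ l) :* s :+ c :+ h := (L :* s :+ c :+ h) :+ l :* s) refl L l s c (12ℚ ℚ.* g) ⟩
        (L ℚ.* s ℚ.+ c ℚ.+ 12ℚ ℚ.* g) ℚ.+ l ℚ.* s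
          ≤⟨ ℚ.+-mono-≤ (levels-upper M) (level-upper (suc M) (ih M)) ⟩
        (n ℚ.* s ℚ.+ c ℚ.* Z ℚ.+ 12ℚ ℚ.* g ℚ.* Y) ℚ.+ (c ℚ.* weight 10 (suc M) ℚ.+ 12ℚ ℚ.* g ℚ.* weight 4 (suc M))
          ≡⟨ solve 7 (λ t c Z h Y w u → (t :+ c :* Z :+ h :* Y) :+ (c :* w :+ h :* u) := t :+ c :* (Z :+ w) :+ h :* (Y :+ u))
               refl (n ℚ.* s) c Z (12ℚ ℚ.* g) Y (weight 10 (suc M)) (weight 4 (suc M)) ⟩
        n ℚ.* s ℚ.+ c ℚ.* ζ-partial 10 (suc (suc M)) ℚ.+ 12ℚ ℚ.* g ℚ.* ζ-partial 4 (suc (suc M)) ∎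
        where
        open ℚ.≤-Reasoning
        L = ι (length (levels a b (suc M)))
        l = ι (length (level a b (suc M)))
        n = ι (#minimal a b)
        Z = ζ-partial 10 (suc M)
        Y = ζ-partial 4 (suc M)

      levels-lower : ∀ M → ι (#minimal a b) ℚ.* s ℚ.+ c ℚ.* ζ-partial 10 (suc M) ℚ.+ 16ℚ ℚ.* g ℚ.≤
                           ι (length (levels a b (suc M))) ℚ.* s ℚ.+ c ℚ.+ 16ℚ ℚ.* g ℚ.* ζ-partial 4 (suc M)
      levels-lower zero = ℚ.≤-reflexive (begin
        n ℚ.* s ℚ.+ c ℚ.* ζ-partial 10 1 ℚ.+ 16ℚ ℚ.* g
          ≡⟨ cong₂ (λ x y → n ℚ.* s ℚ.+ x ℚ.+ y) (trans (cong (c ℚ.*_) (ζ-partial-1 10)) (ℚ.*-identityʳ c))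
                   (sym (trans (cong (16ℚ ℚ.* g ℚ.*_) (ζ-partial-1 4)) (ℚ.*-identityʳ (16ℚ ℚ.* g)))) ⟩
        n ℚ.* s ℚ.+ c ℚ.+ 16ℚ ℚ.* g ℚ.* ζ-partial 4 1
          ≡⟨ cong (λ k → ι k ℚ.* s ℚ.+ c ℚ.+ 16ℚ ℚ.* g ℚ.* ζ-partial 4 1) levels-zero ⟨
        ι (length (levels a b 1)) ℚ.* s ℚ.+ c ℚ.+ 16ℚ ℚ.* g ℚ.* ζ-partial 4 1 ∎)
        where
        open ≡-Reasoning
        n = ι (#minimal a b)
      levels-lower (suc M) = begin
        n ℚ.* s ℚ.+ c ℚ.* ζ-partial 10 (suc (suc M)) ℚ.+ 16ℚ ℚ.* g
          ≡⟨ solve 5 (λ t c Z w h → t :+ c :* (Z :+ w) :+ h := (t :+ c :* Z :+ h) :+ c :* w) refl (n ℚ.* s) c Z (weight 10 (suc M)) (16ℚ ℚ.* g) ⟩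
        (n ℚ.* s ℚ.+ c ℚ.* Z ℚ.+ 16ℚ ℚ.* g) ℚ.+ c ℚ.* weight 10 (suc M)
          ≤⟨ ℚ.+-mono-≤ (levels-lower M) (level-lower (suc M) (ih M)) ⟩
        (L ℚ.* s ℚ.+ c ℚ.+ 16ℚ ℚ.* g ℚ.* Y) ℚ.+ (l ℚ.* s ℚ.+ 16ℚ ℚ.* g ℚ.* weight 4 (suc M))
          ≡⟨ solve 7 (λ L l s c h Y u → (L :* s :+ c :+ h :* Y) :+ (l :* s :+ h :* u) := (L :+ l) :* s :+ c :+ h :* (Y :+ u))
               refl L l s c (16ℚ ℚ.* g) Y (weight 4 (suc M)) ⟩
        (L ℚ.+ l) ℚ.* s ℚ.+ c ℚ.+ 16ℚ ℚ.* g ℚ.* ζ-partial 4 (suc (suc M))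
          ≡⟨ cong (λ x → x ℚ.* s ℚ.+ c ℚ.+ 16ℚ ℚ.* g ℚ.* ζ-partial 4 (suc (suc M))) (levels-suc (suc M)) ⟨
        ι (length (levels a b (suc (suc M)))) ℚ.* s ℚ.+ c ℚ.+ 16ℚ ℚ.* g ℚ.* ζ-partial 4 (suc (suc M)) ∎
        where
        open ℚ.≤-Reasoning
        L = ι (length (levels a b (suc M)))
        l = ι (length (level a b (suc M)))
        n = ι (#minimal a b)
        Z = ζ-partial 10 (suc M)
        Y = ζ-partial 4 (suc M)

nonsingular-lower-ℚ : ∀ a b → 4ℚ ℚ.* (ι a ℚ.* ι b) ℚ.≤ ι (#nonsingular a b)
nonsingular-lower-ℚ a b = begin
  4ℚ ℚ.* (ι a ℚ.* ι b)   ≡⟨ cong₂ ℚ._*_ ι-4 (ι-* a b) ⟨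
  ι 4 ℚ.* ι (a ℕ.* b)    ≡⟨ ι-* 4 (a ℕ.* b) ⟨
  ι (4 ℕ.* (a ℕ.* b))    ≤⟨ ι-mono (#nonsingular-lower a b) ⟩
  ι (#nonsingular a b)   ∎
  where open ℚ.≤-Reasoning

nonsingular-upper-ℚ : ∀ a b → ι (#nonsingular a b) ℚ.≤ 4ℚ ℚ.* (ι a ℚ.* ι b) ℚ.+ (1ℚ ℚ.+ 1ℚ) ℚ.* (ι a ℚ.+ ι b)
nonsingular-upper-ℚ a b = begin
  ι (#nonsingular a b)                          ≤⟨ ι-mono (#nonsingular-upper a b) ⟩
  ι (4 ℕ.* (a ℕ.* b) ℕ.+ 2 ℕ.* (a ℕ.+ b))       ≡⟨ ι-+ (4 ℕ.* (a ℕ.* b)) (2 ℕ.* (a ℕ.+ b)) ⟩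
  ι (4 ℕ.* (a ℕ.* b)) ℚ.+ ι (2 ℕ.* (a ℕ.+ b))
    ≡⟨ cong₂ ℚ._+_ (trans (ι-* 4 (a ℕ.* b)) (cong₂ ℚ._*_ ι-4 (ι-* a b)))
                   (trans (ι-* 2 (a ℕ.+ b)) (cong₂ ℚ._*_ ι-2 (ι-+ a b))) ⟩
  4ℚ ℚ.* (ι a ℚ.* ι b) ℚ.+ (1ℚ ℚ.+ 1ℚ) ℚ.* (ι a ℚ.+ ι b) ∎
  where open ℚ.≤-Reasoning

module _ (n : ℚ) {m s c g Y : ℚ} (0≤s : 0ℚ ℚ.≤ s) (0≤g : 0ℚ ℚ.≤ g) (Y≤ : Y ℚ.≤ 1ℚ ℚ.+ ½) where

  -- Isolating `n * s` leaves s (m - c) + 16 g (Y - 1) beside `c`. The first term is at most 3/2 ·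
  -- 2g = 3g and the second at most 8g; the constant 12 leaves one `g` to spare.
  close-upper : s ℚ.≤ 1ℚ ℚ.+ ½ → m ℚ.≤ c ℚ.+ (1ℚ ℚ.+ 1ℚ) ℚ.* g →
                n ℚ.* s ℚ.+ c ℚ.* s ℚ.+ 16ℚ ℚ.* g ℚ.≤ m ℚ.* s ℚ.+ c ℚ.+ 16ℚ ℚ.* g ℚ.* Y →
                n ℚ.* s ℚ.≤ c ℚ.+ 12ℚ ℚ.* g
  close-upper s≤ m≤ sum≤ = by-difference
    ((m ℚ.* s ℚ.+ c ℚ.+ 16ℚ ℚ.* g ℚ.* Y ℚ.- (n ℚ.* s ℚ.+ c ℚ.* s ℚ.+ 16ℚ ℚ.* g)) ℚ.+
      (s ℚ.* (c ℚ.+ (1ℚ ℚ.+ 1ℚ) ℚ.* g ℚ.- m) ℚ.+ (g ℚ.+ g) ℚ.* (1ℚ ℚ.+ ½ ℚ.- s) ℚ.+ 16ℚ ℚ.* g ℚ.* (1ℚ ℚ.+ ½ ℚ.- Y) ℚ.+ g))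
    (0≤+ (≤⇒0≤- sum≤)
      (0≤+ (0≤+ (0≤+ (0≤* 0≤s (≤⇒0≤- m≤)) (0≤* (0≤+ 0≤g 0≤g) (≤⇒0≤- s≤)))
                (0≤* (0≤* (ℚ.nonNegative⁻¹ 16ℚ) 0≤g) (≤⇒0≤- Y≤))) 0≤g))
    (solve 6 (λ m n s c g Y →
      (m :* s :+ c :+ con 16ℚ :* g :* Y :- (n :* s :+ c :* s :+ con 16ℚ :* g)) :+
      (s :* (c :+ (con 1ℚ :+ con 1ℚ) :* g :- m) :+ (g :+ g) :* (con 1ℚ :+ con ½ :- s) :+ con 16ℚ :* g :* (con 1ℚ :+ con ½ :- Y) :+ g) :=
      c :+ con 12ℚ :* g :- n :* s) refl m n s c g Y)

  -- The only loss is 12 g (Y - 1) ≤ 6g, because c ≤ m has no error term.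
  close-lower : c ℚ.≤ m →
                m ℚ.* s ℚ.+ c ℚ.+ 12ℚ ℚ.* g ℚ.≤ n ℚ.* s ℚ.+ c ℚ.* s ℚ.+ 12ℚ ℚ.* g ℚ.* Y →
                c ℚ.≤ n ℚ.* s ℚ.+ 12ℚ ℚ.* g
  close-lower c≤m sum≤ = by-difference
    ((n ℚ.* s ℚ.+ c ℚ.* s ℚ.+ 12ℚ ℚ.* g ℚ.* Y ℚ.- (m ℚ.* s ℚ.+ c ℚ.+ 12ℚ ℚ.* g)) ℚ.+
      (s ℚ.* (m ℚ.- c) ℚ.+ 12ℚ ℚ.* g ℚ.* (1ℚ ℚ.+ ½ ℚ.- Y) ℚ.+ 6ℚ ℚ.* g))
    (0≤+ (≤⇒0≤- sum≤)
      (0≤+ (0≤+ (0≤* 0≤s (≤⇒0≤- c≤m)) (0≤* (0≤* 0≤12 0≤g) (≤⇒0≤- Y≤))) (0≤* (ℚ.nonNegative⁻¹ 6ℚ) 0≤g)))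
    (solve 6 (λ m n s c g Y →
      (n :* s :+ c :* s :+ con 12ℚ :* g :* Y :- (m :* s :+ c :+ con 12ℚ :* g)) :+
      (s :* (m :- c) :+ con 12ℚ :* g :* (con 1ℚ :+ con ½ :- Y) :+ con 6ℚ :* g) :=
      n :* s :+ con 12ℚ :* g :- c) refl m n s c g Y)
    where
    6ℚ : ℚ
    6ℚ = + 6 ℚ./ 1

-- The minimal curves are what remains of the nonsingular ones after the levels i ≥ 1, so the
-- directions cross: `levels-lower` yields the upper estimate and `levels-upper` the lower one.
estimate-step : ∀ N a b → a ℕ.⊔ b ℕ.≤ suc N →
  (∀ i → Estimate (ζ-partial 10 (suc N)) (quotient 4 (suc i) a) (quotient 6 (suc i) b)) →
  Estimate (ζ-partial 10 (suc N)) a b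
estimate-step N a b a⊔b≤ ih = record
  { upper = close-upper (ι (#minimal a b)) 0≤s 0≤g Y≤ (ζ-partial-upper 10 N (ℕ.m≤m+n 3 7)) (nonsingular-upper-ℚ a b)
      (subst (λ k → ι (#minimal a b) ℚ.* s ℚ.+ c ℚ.* s ℚ.+ 16ℚ ℚ.* g ℚ.≤ ι k ℚ.* s ℚ.+ c ℚ.+ 16ℚ ℚ.* g ℚ.* ζ-partial 4 (suc N))
        (#levels a b (suc N) a⊔b≤) (levels-lower s a b ih N))
  ; lower = close-lower (ι (#minimal a b)) 0≤s 0≤g Y≤ (nonsingular-lower-ℚ a b)
      (subst (λ k → ι k ℚ.* s ℚ.+ c ℚ.+ 12ℚ ℚ.* g ℚ.≤ ι (#minimal a b) ℚ.* s ℚ.+ c ℚ.* s ℚ.+ 12ℚ ℚ.* g ℚ.* ζ-partial 4 (suc N))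
        (#levels a b (suc N) a⊔b≤) (levels-upper s a b ih N))
  }
  where
  s c g : ℚ
  s = ζ-partial 10 (suc N)
  c = 4ℚ ℚ.* (ι a ℚ.* ι b)
  g = ι a ℚ.+ ι b
  0≤s : 0ℚ ℚ.≤ s
  0≤s = ℚ.≤-trans (ℚ.nonNegative⁻¹ 1ℚ) (ζ-partial-lower 10 N)
  0≤g : 0ℚ ℚ.≤ g
  0≤g = 0≤+ (0≤ι a) (0≤ι b)
  Y≤ = ζ-partial-upper 4 N (ℕ.m≤m+n 3 1)

estimate-empty : ∀ s → Estimate s 0 0
estimate-empty s = record
  { upper = ℚ.≤-trans (ℚ.≤-reflexive #s≡0)
      (0≤+ (0≤* 0≤4 (0≤* (0≤ι 0) (0≤ι 0))) (0≤* 0≤12 (0≤+ (0≤ι 0) (0≤ι 0))))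
  ; lower = ℚ.≤-trans
      (ℚ.≤-reflexive (trans (cong (4ℚ ℚ.*_) (trans (cong (ℚ._* ι 0) ι-0) (ℚ.*-zeroˡ (ι 0)))) (ℚ.*-zeroʳ 4ℚ)))
      (0≤+ (ℚ.≤-reflexive (sym #s≡0)) (0≤* 0≤12 (0≤+ (0≤ι 0) (0≤ι 0))))
  }
  where
  #s≡0 : ι (#minimal 0 0) ℚ.* s ≡ 0ℚ
  #s≡0 = trans (cong (ℚ._* s) (trans (cong ι (ℕ.n≤0⇒n≡0 (ℕ.≤-trans (#minimal≤#nonsingular 0 0) (#nonsingular-upper 0 0)))) ι-0))
               (ℚ.*-zeroˡ s)

-- `N` stays fixed while the box shrinks, so every box is compared with the same partial sum.
-- Division by (i + 2)⁴ or (i + 2)⁶ strictly lowers a nonzero side, so `a + b` decreases until the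
-- box is the origin.
estimate : ∀ N a b → a ℕ.⊔ b ℕ.≤ suc N → Estimate (ζ-partial 10 (suc N)) a b
estimate N a b = go a b (<-wellFounded (a ℕ.+ b))
  where
  quotients≤ : ∀ a b i → a ℕ.⊔ b ℕ.≤ suc N → quotient 4 (suc i) a ℕ.⊔ quotient 6 (suc i) b ℕ.≤ suc N
  quotients≤ a b i = ℕ.≤-trans (ℕ.⊔-mono-≤ (quotient-≤ 4 (suc i) a) (quotient-≤ 6 (suc i) b))

  go : ∀ a b → Acc ℕ._<_ (a ℕ.+ b) → a ℕ.⊔ b ℕ.≤ suc N → Estimate (ζ-partial 10 (suc N)) a b
  go zero zero _ _ = estimate-empty (ζ-partial 10 (suc N))
  go a@(suc a′) b (acc rec) a⊔b≤ = estimate-step N a b a⊔b≤ λ i →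
    go _ _ (rec (ℕ.+-mono-<-≤ (quotient-< 3 i a′) (quotient-≤ 6 (suc i) b))) (quotients≤ a b i a⊔b≤)
  go zero b@(suc b′) (acc rec) a⊔b≤ = estimate-step N 0 b a⊔b≤ λ i →
    go _ _ (rec (ℕ.+-mono-≤-< (quotient-≤ 4 (suc i) 0) (quotient-< 5 i b′))) (quotients≤ 0 b i a⊔b≤)

-- From the count to the ratio

1≤2*n/[1+n] : ∀ n .{{_ : ℕ.NonZero n}} → 1ℚ ℚ.≤ (1ℚ ℚ.+ 1ℚ) ℚ.* (1/ℕ (suc n) ℚ.* ι n)
1≤2*n/[1+n] n = begin
  1ℚ                                    ≡⟨ 1/ℕ-inverse (suc n) ⟨
  p ℚ.* ι (suc n)
    ≤⟨ ℚ.*-monoˡ-≤-nonNeg p {{ℚ.nonNegative (ℚ.<⇒≤ (0<1/ℕ (suc n)))}} (ι-mono (ℕ.+-monoˡ-≤ n (ℕ.>-nonZero⁻¹ n))) ⟩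
  p ℚ.* ι (n ℕ.+ n)                     ≡⟨ cong (p ℚ.*_) (ι-+ n n) ⟩
  p ℚ.* (ι n ℚ.+ ι n)                   ≡⟨ solve 2 (λ p x → p :* (x :+ x) := (con 1ℚ :+ con 1ℚ) :* (p :* x)) refl p (ι n) ⟩
  (1ℚ ℚ.+ 1ℚ) ℚ.* (p ℚ.* ι n)           ∎
  where
  open ℚ.≤-Reasoning
  p = 1/ℕ (suc n)

-- For p = 1/(a + 1) ≥ 1/(2a) and q = 1/(b + 1) ≥ 1/(2b) the right side is at least 28ab (1/(2a) +
-- 1/(2b)) = 14 (a + b). Here 14 = 12 + 2 combines the errors of the minimal and the nonsingular
-- count. The denominators are a + 1 and b + 1 because the height fails to fit exactly there.
main-term-dominates : ∀ α β p q → 0ℚ ℚ.≤ α → 0ℚ ℚ.≤ β →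
  1ℚ ℚ.≤ (1ℚ ℚ.+ 1ℚ) ℚ.* (p ℚ.* α) → 1ℚ ℚ.≤ (1ℚ ℚ.+ 1ℚ) ℚ.* (q ℚ.* β) →
  14ℚ ℚ.* (α ℚ.+ β) ℚ.≤ 7ℚ ℚ.* (p ℚ.+ q) ℚ.* (4ℚ ℚ.* (α ℚ.* β))
main-term-dominates α β p q 0≤α 0≤β 1≤p 1≤q = by-difference
  (14ℚ ℚ.* β ℚ.* ((1ℚ ℚ.+ 1ℚ) ℚ.* (p ℚ.* α) ℚ.- 1ℚ) ℚ.+ 14ℚ ℚ.* α ℚ.* ((1ℚ ℚ.+ 1ℚ) ℚ.* (q ℚ.* β) ℚ.- 1ℚ))
  (0≤+ (0≤* (0≤* (ℚ.nonNegative⁻¹ 14ℚ) 0≤β) (≤⇒0≤- 1≤p)) (0≤* (0≤* (ℚ.nonNegative⁻¹ 14ℚ) 0≤α) (≤⇒0≤- 1≤q)))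
  (solve 4 (λ α β p q →
    con 14ℚ :* β :* ((con 1ℚ :+ con 1ℚ) :* (p :* α) :- con 1ℚ) :+ con 14ℚ :* α :* ((con 1ℚ :+ con 1ℚ) :* (q :* β) :- con 1ℚ) :=
    con 7ℚ :* (p :+ q) :* (con 4ℚ :* (α :* β)) :- con 14ℚ :* (α :+ β)) refl α β p q)

-- f = n / M and r = 1 / s, compared after multiplication by M s.
module _ (f r : ℚ) {M n s c g ρ : ℚ} (0<M : 0ℚ ℚ.< M) (1≤s : 1ℚ ℚ.≤ s) (f*M≡n : f ℚ.* M ≡ n) (s*r≡1 : s ℚ.* r ≡ 1ℚ)
         (c≤M : c ℚ.≤ M) (M≤ : M ℚ.≤ c ℚ.+ (1ℚ ℚ.+ 1ℚ) ℚ.* g)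
         (n*s≤ : n ℚ.* s ℚ.≤ c ℚ.+ 12ℚ ℚ.* g) (≤n*s : c ℚ.≤ n ℚ.* s ℚ.+ 12ℚ ℚ.* g)
         (0≤g : 0ℚ ℚ.≤ g) (0≤ρ : 0ℚ ℚ.≤ ρ) (14g≤ : 14ℚ ℚ.* g ℚ.≤ ρ ℚ.* c) where

  private
    instance
      positive : ℚ.Positive (M ℚ.* s)
      positive = ℚ.positive (*-pos 0<M (ℚ.<-≤-trans (ℚ.positive⁻¹ 1ℚ) 1≤s))

    14g≤ρMs : 14ℚ ℚ.* g ℚ.≤ ρ ℚ.* (M ℚ.* s)
    14g≤ρMs = by-difference
      ((ρ ℚ.* c ℚ.- 14ℚ ℚ.* g) ℚ.+ ρ ℚ.* ((M ℚ.- c) ℚ.+ M ℚ.* (s ℚ.- 1ℚ)))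
      (0≤+ (≤⇒0≤- 14g≤) (0≤* 0≤ρ (0≤+ (≤⇒0≤- c≤M) (0≤* (ℚ.<⇒≤ 0<M) (≤⇒0≤- 1≤s)))))
      (solve 5 (λ ρ c g M s → (ρ :* c :- con 14ℚ :* g) :+ ρ :* ((M :- c) :+ M :* (s :- con 1ℚ)) := ρ :* (M :* s) :- con 14ℚ :* g) refl ρ c g M s)

    cleared-f : f ℚ.* (M ℚ.* s) ≡ n ℚ.* s
    cleared-f = trans (sym (ℚ.*-assoc f M s)) (cong (ℚ._* s) f*M≡n)

    cleared-r : r ℚ.* (M ℚ.* s) ≡ M
    cleared-r = trans (solve 3 (λ r M s → r :* (M :* s) := M :* (s :* r)) refl r M s) (trans (cong (M ℚ.*_) s*r≡1) (ℚ.*-identityʳ M))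

  quotient-close : ℚ.∣ f ℚ.- r ∣ ℚ.≤ ρ
  quotient-close = ∣p-q∣≤r {f} {r} {ρ}
    (ℚ.*-cancelʳ-≤-pos (M ℚ.* s) (begin
      f ℚ.* (M ℚ.* s)          ≡⟨ cleared-f ⟩
      n ℚ.* s                  ≤⟨ by-difference
        ((c ℚ.+ 12ℚ ℚ.* g ℚ.- n ℚ.* s) ℚ.+ ((M ℚ.- c) ℚ.+ (g ℚ.+ g)))
        (0≤+ (≤⇒0≤- n*s≤) (0≤+ (≤⇒0≤- c≤M) (0≤+ 0≤g 0≤g)))
        (solve 5 (λ c g n s M → (c :+ con 12ℚ :* g :- n :* s) :+ ((M :- c) :+ (g :+ g)) := M :+ con 14ℚ :* g :- n :* s) refl c g n s M) ⟩
      M ℚ.+ 14ℚ ℚ.* g          ≤⟨ ℚ.+-mono-≤ (ℚ.≤-reflexive (sym cleared-r)) 14g≤ρMs ⟩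
      r ℚ.* (M ℚ.* s) ℚ.+ ρ ℚ.* (M ℚ.* s) ≡⟨ ℚ.*-distribʳ-+ (M ℚ.* s) r ρ ⟨
      (r ℚ.+ ρ) ℚ.* (M ℚ.* s)  ∎))
    (ℚ.*-cancelʳ-≤-pos (M ℚ.* s) (begin
      r ℚ.* (M ℚ.* s)          ≡⟨ cleared-r ⟩
      M                        ≤⟨ by-difference
        ((c ℚ.+ (1ℚ ℚ.+ 1ℚ) ℚ.* g ℚ.- M) ℚ.+ (n ℚ.* s ℚ.+ 12ℚ ℚ.* g ℚ.- c))
        (0≤+ (≤⇒0≤- M≤) (≤⇒0≤- ≤n*s))
        (solve 5 (λ c g n s M → (c :+ (con 1ℚ :+ con 1ℚ) :* g :- M) :+ (n :* s :+ con 12ℚ :* g :- c) := n :* s :+ con 14ℚ :* g :- M) refl c g n s M) ⟩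
      n ℚ.* s ℚ.+ 14ℚ ℚ.* g    ≤⟨ ℚ.+-mono-≤ (ℚ.≤-reflexive (sym cleared-f)) 14g≤ρMs ⟩
      f ℚ.* (M ℚ.* s) ℚ.+ ρ ℚ.* (M ℚ.* s) ≡⟨ ℚ.*-distribʳ-+ (M ℚ.* s) f ρ ⟨
      (f ℚ.+ ρ) ℚ.* (M ℚ.* s)  ∎))
    where open ℚ.≤-Reasoning

#nonsingular-nonZero : ∀ a b .{{_ : ℕ.NonZero a}} .{{_ : ℕ.NonZero b}} → ℕ.NonZero (#nonsingular a b)
#nonsingular-nonZero a b = ℕ.>-nonZero (ℕ.<-≤-trans (ℕ.>-nonZero⁻¹ (4 ℕ.* (a ℕ.* b)) {{ℕ.m*n≢0 4 (a ℕ.* b) {{_}} {{ℕ.m*n≢0 a b}}}}) (#nonsingular-lower a b))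

ratio-close : ∀ a b .{{_ : ℕ.NonZero a}} .{{_ : ℕ.NonZero b}} .{{_ : ℕ.NonZero (#nonsingular a b)}} N r →
  a ℕ.⊔ b ℕ.≤ suc N → ζ-partial 10 (suc N) ℚ.* r ≡ 1ℚ →
  ℚ.∣ + #minimal a b ℚ./ #nonsingular a b ℚ.- r ∣ ℚ.≤ 7ℚ ℚ.* (1/ℕ (suc a) ℚ.+ 1/ℕ (suc b))
ratio-close a b N r a⊔b≤ s*r≡1 = quotient-close (+ #minimal a b ℚ./ #nonsingular a b) r
  (0<ι (#nonsingular a b)) (ζ-partial-lower 10 N) (fraction-* (#minimal a b) (#nonsingular a b)) s*r≡1
  (nonsingular-lower-ℚ a b) (nonsingular-upper-ℚ a b) (Estimate.upper e) (Estimate.lower e)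
  (0≤+ (0≤ι a) (0≤ι b))
  (0≤* (ℚ.nonNegative⁻¹ 7ℚ) (0≤+ (ℚ.<⇒≤ (0<1/ℕ (suc a))) (ℚ.<⇒≤ (0<1/ℕ (suc b)))))
  (main-term-dominates (ι a) (ι b) (1/ℕ (suc a)) (1/ℕ (suc b)) (0≤ι a) (0≤ι b) (1≤2*n/[1+n] a) (1≤2*n/[1+n] b))
  where
  e : Estimate (ζ-partial 10 (suc N)) a b
  e = estimate N a b a⊔b≤

-- From the box to the height

⊔-≤⁻ : ∀ {x y z} → x ⊔ y ≤ z → x ≤ z × y ≤ z
⊔-≤⁻ {x} {y} x⊔y≤z =
  (λ ε 0<ε → let N , h = x⊔y≤z ε 0<ε in N , λ n N≤n → ℚ.≤-trans (ℚ.p≤p⊔q (seq x n) (seq y n)) (h n N≤n)) ,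
  (λ ε 0<ε → let N , h = x⊔y≤z ε 0<ε in N , λ n N≤n → ℚ.≤-trans (ℚ.p≤q⊔p (seq x n) (seq y n)) (h n N≤n))

⊔-≤⁺ : ∀ {x y z} → x ≤ z → y ≤ z → x ⊔ y ≤ z
⊔-≤⁺ x≤z y≤z ε 0<ε =
  let M , h = x≤z ε 0<ε
      N , k = y≤z ε 0<ε
  in M ℕ.⊔ N , λ n le → ℚ.⊔-lub (h n (ℕ.m⊔n≤o⇒m≤o M N le)) (k n (ℕ.m⊔n≤o⇒n≤o M N le))

≤-eventually : ∀ {x y z : ℝ} → (∃[ N ] ∀ n → N ℕ.≤ n → seq x n ℚ.≤ seq y n) → y ≤ z → x ≤ z
≤-eventually (M , h) y≤z ε 0<ε =
  let N , k = y≤z ε 0<ε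
  in M ℕ.⊔ N , λ n le → ℚ.≤-trans (h n (ℕ.m⊔n≤o⇒m≤o M N le)) (k n (ℕ.m⊔n≤o⇒n≤o M N le))

1≤⇒eventually-0≤ : ∀ {x} → 1ℝ ≤ x → ∃[ N ] ∀ n → N ℕ.≤ n → 0ℚ ℚ.≤ seq x n
1≤⇒eventually-0≤ {x} 1≤x =
  let N , h = 1≤x 1ℚ (ℚ.positive⁻¹ 1ℚ)
  in N , λ n N≤n → by-difference (seq x n ℚ.+ 1ℚ ℚ.- 1ℚ) (≤⇒0≤- (h n N≤n))
       (solve 1 (λ x → x :+ con 1ℚ :- con 1ℚ := x :- con 0ℚ) refl (seq x n))

seq-^ : ∀ k e n → seq (fromℤ (+ k) ^ e) n ≡ ι (k ℕ.^ e)
seq-^ k zero    n = sym ι-1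
seq-^ k (suc e) n = trans (cong₂ ℚ._*_ (sym (ι-def k)) (seq-^ k e n)) (sym (ι-* k (k ℕ.^ e)))

seq-square-abs : ∀ B n → seq (fromℤ B ^ 2) n ≡ seq (fromℤ (+ ℤ.∣ B ∣) ^ 2) n
seq-square-abs (+ _)    n = refl
seq-square-abs -[1+ m ] n = solve 1 (λ x → (:- x) :* ((:- x) :* con 1ℚ) := x :* (x :* con 1ℚ)) refl (+ suc m ℚ./ 1)

-- The two exponents may differ, so that besides monotonicity in the base this also compares a
-- square with a cube.
monomial-antitone : ∀ {γ X} → 1ℝ ≤ γ → ∀ k l e f → k ℕ.^ e ℕ.≤ l ℕ.^ f →
                    γ * fromℤ (+ l) ^ f ≤ X → γ * fromℤ (+ k) ^ e ≤ X
monomial-antitone {γ} {X} 1≤γ k l e f kᵉ≤lᶠ = ≤-eventually {γ * fromℤ (+ k) ^ e} {γ * fromℤ (+ l) ^ f} {X}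
  (let N , h = 1≤⇒eventually-0≤ {γ} 1≤γ in N , λ n N≤n →
    ℚ.*-monoˡ-≤-nonNeg (seq γ n) {{ℚ.nonNegative (h n N≤n)}}
      (subst₂ ℚ._≤_ (sym (seq-^ k e n)) (sym (seq-^ l f n)) (ι-mono kᵉ≤lᶠ)))

square-abs : ∀ {γ X} B → γ * fromℤ B ^ 2 ≤ X → γ * fromℤ (+ ℤ.∣ B ∣) ^ 2 ≤ X
square-abs {γ} {X} B = ≤-eventually {γ * fromℤ (+ ℤ.∣ B ∣) ^ 2} {γ * fromℤ B ^ 2} {X}
  (0 , λ n _ → ℚ.≤-reflexive (cong (seq γ n ℚ.*_) (sym (seq-square-abs B n))))

square-abs⁻ : ∀ {γ X} B → γ * fromℤ (+ ℤ.∣ B ∣) ^ 2 ≤ X → γ * fromℤ B ^ 2 ≤ X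
square-abs⁻ {γ} {X} B = ≤-eventually {γ * fromℤ B ^ 2} {γ * fromℤ (+ ℤ.∣ B ∣) ^ 2} {X}
  (0 , λ n _ → ℚ.≤-reflexive (cong (seq γ n ℚ.*_) (seq-square-abs B n)))

EventuallyBounded : ℝ → ℚ → Set
EventuallyBounded x K = ∃[ N ] ∀ n → N ℕ.≤ n → seq x n ℚ.≤ K

-- This is the role of the threshold for X: once X ≥ K the coefficient 1 fits in both directions, so
-- a and b are positive.
monomial-one : ∀ {γ X K} e → EventuallyBounded γ K → fromℚ K ≤ X → γ * fromℤ (+ 1) ^ e ≤ X
monomial-one {γ} {X} {K} e (N , h) = ≤-eventually {γ * fromℤ (+ 1) ^ e} {fromℚ K} {X}
  (N , λ n N≤n → subst (ℚ._≤ K)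
    (sym (trans (cong (seq γ n ℚ.*_) (trans (seq-^ 1 e n) (trans (cong ι (ℕ.^-zeroˡ e)) ι-1))) (ℚ.*-identityʳ (seq γ n))))
    (h n N≤n))

-- With z = K ρ (c + 1) ≤ w < 1 one has K ρ³ (c + 1)³ ≤ z³ ≤ z.
cube-bound : ∀ {K ρ x w : ℚ} → 1ℚ ℚ.≤ K → 0ℚ ℚ.≤ ρ → 0ℚ ℚ.≤ x → K ℚ.* ρ ℚ.* x ℚ.≤ w → w ℚ.≤ 1ℚ →
             K ℚ.* (x ℚ.* (x ℚ.* x)) ℚ.* (ρ ℚ.* (ρ ℚ.* ρ)) ℚ.≤ w
cube-bound {K} {ρ} {x} {w} 1≤K 0≤ρ 0≤x z≤w w≤1 = begin
  K ℚ.* (x ℚ.* (x ℚ.* x)) ℚ.* (ρ ℚ.* (ρ ℚ.* ρ))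
    ≡⟨ solve 3 (λ K ρ x → K :* (x :* (x :* x)) :* (ρ :* (ρ :* ρ)) := K :* ρ :* x :* (con 1ℚ :* (ρ :* x) :* (con 1ℚ :* (ρ :* x)))) refl K ρ x ⟩
  z ℚ.* (1ℚ ℚ.* (ρ ℚ.* x) ℚ.* (1ℚ ℚ.* (ρ ℚ.* x)))
    ≤⟨ ℚ.*-monoˡ-≤-nonNeg z {{ℚ.nonNegative 0≤z}} (*-mono (0≤* (ℚ.nonNegative⁻¹ 1ℚ) 0≤ρx) (ℚ.nonNegative⁻¹ 1ℚ) 1ρx≤1 1ρx≤1) ⟩
  z ℚ.* (1ℚ ℚ.* 1ℚ)
    ≡⟨ ℚ.*-identityʳ z ⟩
  z ≤⟨ z≤w ⟩
  w ∎
  where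
  open ℚ.≤-Reasoning
  z = K ℚ.* ρ ℚ.* x
  0≤ρx : 0ℚ ℚ.≤ ρ ℚ.* x
  0≤ρx = 0≤* 0≤ρ 0≤x
  0≤z : 0ℚ ℚ.≤ z
  0≤z = 0≤* (0≤* (ℚ.≤-trans (ℚ.nonNegative⁻¹ 1ℚ) 1≤K) 0≤ρ) 0≤x
  1ρx≤1 : 1ℚ ℚ.* (ρ ℚ.* x) ℚ.≤ 1ℚ
  1ρx≤1 = ℚ.≤-trans (ℚ.*-monoʳ-≤-nonNeg (ρ ℚ.* x) {{ℚ.nonNegative 0≤ρx}} 1≤K)
    (ℚ.≤-trans (ℚ.≤-reflexive (sym (ℚ.*-assoc K ρ x))) (ℚ.≤-trans z≤w w≤1))

-- The hypothesis is only a negation, but the conclusion asks, for each ε, for an inequality between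
-- rationals, which can be decided. If 1/(c + 1) exceeded a late value of K r by more than ε/2, then
-- K r (c + 1) would stay below some w < 1. By `cube-bound`, γ (c + 1)³ r³ ≤ w ≤ r³ X would follow,
-- and cancelling r³ contradicts the hypothesis.
reciprocal-root-bound : ∀ {γ X r K} c → 1ℚ ℚ.≤ K → EventuallyBounded γ K → r Is X ^-⅓ →
                        ¬ (γ * fromℤ (+ suc c) ^ 3 ≤ X) → fromℚ (1/ℕ (suc c)) ≤ fromℚ K * r
reciprocal-root-bound {γ} {X} {r} {K} c 1≤K (Nγ , γ≤K) ((e , 0<e , Nr , r-pos) , r³X≈1) γx³≰X ε 0<ε =
  decide (p ℚ.≤? v)
  where
  open ℚ.≤-Reasoning
  p x h δ v : ℚ
  0<K : 0ℚ ℚ.< K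
  N : ℕ
  p = 1/ℕ (suc c)
  x = ι (suc c)
  h = ε ℚ.* ½
  0<K = ℚ.<-≤-trans (ℚ.positive⁻¹ 1ℚ) 1≤K
  δ = h ℚ.* recip K 0<K
  N = proj₁ (cauchy r δ (*-pos (*-pos 0<ε 0<½) (recip-pos K 0<K)))
  v = K ℚ.* seq r N ℚ.+ h

  Kδ≡h : K ℚ.* δ ≡ h
  Kδ≡h = trans (solve 3 (λ K h k → K :* (h :* k) := K :* k :* h) refl K h (recip K 0<K))
    (trans (cong (ℚ._* h) (*-recip K 0<K)) (ℚ.*-identityˡ h))

  near : ∀ m n → N ℕ.≤ m → N ℕ.≤ n → K ℚ.* seq r m ℚ.≤ K ℚ.* seq r n ℚ.+ h
  near m n N≤m N≤n = begin
    K ℚ.* seq r m                ≤⟨ ℚ.*-monoˡ-≤-nonNeg K {{ℚ.nonNegative (ℚ.<⇒≤ 0<K)}}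
      (ℚ.≤-trans (p≤q+∣p-q∣ (seq r m) (seq r n))
        (ℚ.+-monoʳ-≤ (seq r n) (proj₂ (cauchy r δ (*-pos (*-pos 0<ε 0<½) (recip-pos K 0<K))) m n N≤m N≤n))) ⟩
    K ℚ.* (seq r n ℚ.+ δ)        ≡⟨ ℚ.*-distribˡ-+ K (seq r n) δ ⟩
    K ℚ.* seq r n ℚ.+ K ℚ.* δ    ≡⟨ cong (K ℚ.* seq r n ℚ.+_) Kδ≡h ⟩
    K ℚ.* seq r n ℚ.+ h          ∎

  0<r : ∀ n → Nr ℕ.≤ n → 0ℚ ℚ.< seq r n
  0<r n Nr≤n = ℚ.<-≤-trans 0<e (ℚ.≤-trans (ℚ.≤-reflexive (sym (ℚ.+-identityˡ e))) (r-pos n Nr≤n))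

  γx³≤X : v ℚ.< p → γ * fromℤ (+ suc c) ^ 3 ≤ X
  γx³≤X v<p ε′ 0<ε′ = N ℕ.⊔ (Nγ ℕ.⊔ (Nr ℕ.⊔ N₃)) , λ n le →
    let N≤n  = ℕ.m⊔n≤o⇒m≤o N (Nγ ℕ.⊔ (Nr ℕ.⊔ N₃)) le
        le₁  = ℕ.m⊔n≤o⇒n≤o N (Nγ ℕ.⊔ (Nr ℕ.⊔ N₃)) le
        Nγ≤n = ℕ.m⊔n≤o⇒m≤o Nγ (Nr ℕ.⊔ N₃) le₁
        le₂  = ℕ.m⊔n≤o⇒n≤o Nγ (Nr ℕ.⊔ N₃) le₁
        Nr≤n = ℕ.m⊔n≤o⇒m≤o Nr N₃ le₂
        N₃≤n = ℕ.m⊔n≤o⇒n≤o Nr N₃ le₂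
    in ℚ.≤-trans (bound n N≤n (γ≤K n Nγ≤n) (0<r n Nr≤n) (proj₂ (r³X≈1 η 0<η) n N₃≤n))
         (ℚ.≤-trans (ℚ.≤-reflexive (sym (ℚ.+-identityʳ (seq X n)))) (ℚ.+-monoʳ-≤ (seq X n) (ℚ.<⇒≤ 0<ε′)))
    where
    w η : ℚ
    w = v ℚ.* x
    -- With this tolerance, ∣r³X - 1∣ ≤ η says in particular that w ≤ r³X.
    η = 1ℚ ℚ.- w
    w<1 : w ℚ.< 1ℚ
    w<1 = subst (w ℚ.<_) (1/ℕ-inverse (suc c)) (ℚ.*-monoˡ-<-pos x {{ℚ.positive (0<ι (suc c))}} v<p)
    0<η : 0ℚ ℚ.< η
    0<η = subst (ℚ._< η) (ℚ.+-inverseʳ w) (ℚ.+-monoˡ-< (ℚ.- w) w<1)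
    N₃ : ℕ
    N₃ = proj₁ (r³X≈1 η 0<η)
    seq-cube : ∀ n → seq (fromℤ (+ suc c) ^ 3) n ≡ x ℚ.* (x ℚ.* x)
    seq-cube n = trans (cong (λ y → y ℚ.* (y ℚ.* (y ℚ.* 1ℚ))) (sym (ι-def (suc c))))
                       (cong (λ y → x ℚ.* (x ℚ.* y)) (ℚ.*-identityʳ x))
    bound : ∀ n → N ℕ.≤ n → seq γ n ℚ.≤ K → 0ℚ ℚ.< seq r n →
            ℚ.∣ seq (r ^ 3 * X) n ℚ.- 1ℚ ∣ ℚ.≤ η →
            seq γ n ℚ.* seq (fromℤ (+ suc c) ^ 3) n ℚ.≤ seq X n
    bound n N≤n γₙ≤K 0<ρ r³X-1≤η = ℚ.*-cancelʳ-≤-pos ρ³ {{ℚ.positive (*-pos 0<ρ (*-pos 0<ρ 0<ρ))}} (begin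
      seq γ n ℚ.* seq (fromℤ (+ suc c) ^ 3) n ℚ.* ρ³
        ≡⟨ cong (λ y → seq γ n ℚ.* y ℚ.* ρ³) (seq-cube n) ⟩
      seq γ n ℚ.* (x ℚ.* (x ℚ.* x)) ℚ.* ρ³
        ≤⟨ ℚ.*-monoʳ-≤-nonNeg ρ³ {{ℚ.nonNegative (ℚ.<⇒≤ (*-pos 0<ρ (*-pos 0<ρ 0<ρ)))}}
             (ℚ.*-monoʳ-≤-nonNeg (x ℚ.* (x ℚ.* x)) {{ℚ.nonNegative (0≤* 0≤x (0≤* 0≤x 0≤x))}} γₙ≤K) ⟩
      K ℚ.* (x ℚ.* (x ℚ.* x)) ℚ.* ρ³
        ≤⟨ cube-bound 1≤K (ℚ.<⇒≤ 0<ρ) 0≤x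
             (ℚ.*-monoʳ-≤-nonNeg x {{ℚ.nonNegative 0≤x}} (near n N N≤n ℕ.≤-refl)) (ℚ.<⇒≤ w<1) ⟩
      w
        ≤⟨ by-difference (seq (r ^ 3 * X) n ℚ.+ η ℚ.- 1ℚ)
             (≤⇒0≤- (ℚ.≤-trans (p≤q+∣p-q∣ 1ℚ (seq (r ^ 3 * X) n))
               (ℚ.+-monoʳ-≤ (seq (r ^ 3 * X) n) (ℚ.≤-trans (ℚ.≤-reflexive (∣p-q∣-comm 1ℚ (seq (r ^ 3 * X) n))) r³X-1≤η))))
             (solve 2 (λ y w → y :+ (con 1ℚ :- w) :- con 1ℚ := y :- w) refl (seq (r ^ 3 * X) n) w) ⟩
      seq (r ^ 3 * X) n
        ≡⟨ solve 2 (λ ρ X → ρ :* (ρ :* (ρ :* con 1ℚ)) :* X := X :* (ρ :* (ρ :* ρ))) refl ρ (seq X n) ⟩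
      seq X n ℚ.* ρ³ ∎)
      where
      ρ ρ³ : ℚ
      ρ  = seq r n
      ρ³ = ρ ℚ.* (ρ ℚ.* ρ)
      0≤x : 0ℚ ℚ.≤ x
      0≤x = 0≤ι (suc c)

  decide : Dec (p ℚ.≤ v) → ∃[ M ] ∀ n → M ℕ.≤ n → p ℚ.≤ K ℚ.* seq r n ℚ.+ ε
  decide (no p≰v)  = contradiction (γx³≤X (ℚ.≰⇒> p≰v)) γx³≰X
  decide (yes p≤v) = N , λ n N≤n → begin
    p                                   ≤⟨ p≤v ⟩
    K ℚ.* seq r N ℚ.+ h                 ≤⟨ ℚ.+-monoˡ-≤ h (near N n ℕ.≤-refl N≤n) ⟩
    K ℚ.* seq r n ℚ.+ h ℚ.+ h           ≡⟨ ℚ.+-assoc (K ℚ.* seq r n) h h ⟩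
    K ℚ.* seq r n ℚ.+ (h ℚ.+ h)         ≡⟨ cong (K ℚ.* seq r n ℚ.+_) (half+half ε) ⟩
    K ℚ.* seq r n ℚ.+ ε                 ∎

-- Reading the box off a cardinality witness

_≟ᶜ_ : DecidableEquality Curve
E A B ≟ᶜ E A′ B′ = map′ (λ (A≡ , B≡) → cong₂ E A≡ B≡) (λ { refl → refl , refl }) (A ℤ.≟ A′ ×-dec B ℤ.≟ B′)

last-success : ∀ {P : ℕ → Set} → (∀ k → Dec (P k)) → P 1 → ∀ bound → ¬ P (suc bound) →
               ∃[ k ] ℕ.NonZero k × P k × ¬ P (suc k)
last-success P? P1 zero        ¬P = contradiction P1 ¬P
last-success P? P1 (suc bound) ¬P with P? (suc bound)
... | yes P[1+bound] = suc bound , _ , P[1+bound] , ¬P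
... | no ¬P[1+bound] = last-success P? P1 bound ¬P[1+bound]

-- Membership in the list xs makes the real inequalities P k decidable.
threshold : ∀ {P : ℕ → Set} (f : ℕ → Curve) xs → (∀ {k l} → f k ≡ f l → k ≡ l) → (∀ k → P k ⇔ f k ∈ xs) →
            (∀ {k l} → k ℕ.≤ l → P l → P k) → P 1 →
            ∃[ n ] ℕ.NonZero n × (∀ k → P k ⇔ k ℕ.≤ n) × ¬ P (suc n)
threshold {P} f xs f-injective P⇔∈ P-closed P1 =
  let n , n≢0 , Pn , ¬P[1+n] = last-success P? P1 (length xs) bounded-by-length
  in n , n≢0 ,
     (λ k → mk⇔ (λ Pk → ℕ.≮⇒≥ λ n<k → ¬P[1+n] (P-closed n<k Pk)) (λ k≤n → P-closed k≤n Pn)) , ¬P[1+n]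
  where
  P? : ∀ k → Dec (P k)
  P? k = map′ (Equivalence.from (P⇔∈ k)) (Equivalence.to (P⇔∈ k)) (f k ∈? xs)
    where open DecMembership _≟ᶜ_ using (_∈?_)
  -- Otherwise the curves `f 0`, ..., `f (length xs)` would be one more distinct curve than `xs` has
  -- entries.
  bounded-by-length : ¬ P (suc (length xs))
  bounded-by-length P[1+l] = ℕ.<-irrefl refl (ℕ.≤-trans (ℕ.≤-reflexive (sym (List.length-upTo (suc (length xs)))))
    (length-injective f (Unique.upTo⁺ (suc (length xs)))
      (λ {k} k∈ → Equivalence.to (P⇔∈ k) (P-closed (ℕ.<⇒≤ (∈.∈-upTo⁻ k∈)) P[1+l])) (λ _ _ → f-injective)))

positive-disc : ∀ A B n → + 4 ℤ.* A ℤ.^ 3 ℤ.+ + 27 ℤ.* B ℤ.^ 2 ≡ + suc n → ℰ̃ (E A B)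
positive-disc A B n eq disc≡0 with ℤ.i*j≡0⇒i≡0∨j≡0 (ℤ.- + 16) disc≡0
... | inj₂ sum≡0 = contradiction (trans (sym eq) sum≡0) λ ()

ℰ̃-A-1 : ∀ k → ℰ̃ (E (+ k) (+ 1))
ℰ̃-A-1 k = positive-disc (+ k) (+ 1) (4 ℕ.* k ℕ.^ 3 ℕ.+ 26) (begin
  + 4 ℤ.* (+ k) ℤ.^ 3 ℤ.+ + 27        ≡⟨ cong (λ x → + 4 ℤ.* x ℤ.+ + 27) (pos-^ k 3) ⟨
  + 4 ℤ.* + (k ℕ.^ 3) ℤ.+ + 27        ≡⟨ cong (ℤ._+ + 27) (ℤ.pos-* 4 (k ℕ.^ 3)) ⟨
  + (4 ℕ.* k ℕ.^ 3 ℕ.+ 27)            ≡⟨ cong +_ (ℕ.+-suc (4 ℕ.* k ℕ.^ 3) 26) ⟩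
  + suc (4 ℕ.* k ℕ.^ 3 ℕ.+ 26)        ∎)
  where open ≡-Reasoning

ℰ̃-1-B : ∀ k → ℰ̃ (E (+ 1) (+ k))
ℰ̃-1-B k = positive-disc (+ 1) (+ k) (3 ℕ.+ 27 ℕ.* k ℕ.^ 2) (begin
  + 4 ℤ.+ + 27 ℤ.* (+ k) ℤ.^ 2        ≡⟨ cong (λ x → + 4 ℤ.+ + 27 ℤ.* x) (pos-^ k 2) ⟨
  + 4 ℤ.+ + 27 ℤ.* + (k ℕ.^ 2)        ≡⟨ cong (λ x → + 4 ℤ.+ x) (ℤ.pos-* 27 (k ℕ.^ 2)) ⟨
  + (4 ℕ.+ 27 ℕ.* k ℕ.^ 2)            ∎)
  where open ≡-Reasoning

module _ {α β X : ℝ} {K : ℚ} (1≤α : 1ℝ ≤ α) (1≤β : 1ℝ ≤ β)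
         (α≤K : EventuallyBounded α K) (β≤K : EventuallyBounded β K) (K≤X : fromℚ K ≤ X) where

  private
    PA PB : ℕ → Set
    PA k = α * fromℤ (+ k) ^ 3 ≤ X
    PB k = β * fromℤ (+ k) ^ 2 ≤ X

    PA-1 : PA 1
    PA-1 = monomial-one {α} {X} {K} 3 α≤K K≤X

    PB-1 : PB 1
    PB-1 = monomial-one {β} {X} {K} 2 β≤K K≤X

  height-≤⁺ : ∀ A B → PA ℤ.∣ A ∣ → PB ℤ.∣ B ∣ → H α β (E A B) ≤ X
  height-≤⁺ A B PA-A PB-B = ⊔-≤⁺ {α * fromℤ (+ ℤ.∣ A ∣) ^ 3} {β * fromℤ B ^ 2} {X} PA-A (square-abs⁻ {β} {X} B PB-B)

  height-≤⁻ : ∀ A B → H α β (E A B) ≤ X → PA ℤ.∣ A ∣ × PB ℤ.∣ B ∣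
  height-≤⁻ A B h = let x , y = ⊔-≤⁻ {α * fromℤ (+ ℤ.∣ A ∣) ^ 3} {β * fromℤ B ^ 2} {X} h in x , square-abs {β} {X} B y

  module _ {m} (card : HasCardinality (ℰ̃ ⟨ X ⨾ H α β ⟩) m) where

    private
      xs = proj₁ card
      ∈xs⇔ = proj₁ (proj₂ (proj₂ card))

    -- The curves (k , 1) and (1 , k) are nonsingular for all k ≥ 0, since 4k³ + 27 and 4 + 27k² are
    -- positive. As the coordinate 1 always fits, their presence in the list tests the bound on |A|
    -- and the bound on |B| separately.
    height-box : ∃[ a ] ∃[ b ] ℕ.NonZero a × ℕ.NonZero b ×
                 (∀ C → H α β C ≤ X ⇔ InBox a b C) × ¬ PA (suc a) × ¬ PB (suc b)
    height-box =
      let a , a≢0 , PA⇔ , ¬PA = threshold (λ k → E (+ k) (+ 1)) xs (λ { refl → refl })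
            (λ k → mk⇔ (λ PA-k → Equivalence.from (∈xs⇔ _) (ℰ̃-A-1 k , height-≤⁺ (+ k) (+ 1) PA-k PB-1))
                       (λ C∈ → proj₁ (height-≤⁻ (+ k) (+ 1) (proj₂ (Equivalence.to (∈xs⇔ _) C∈)))))
            (λ {k} {l} k≤l → monomial-antitone {α} {X} 1≤α k l 3 3 (ℕ.^-monoˡ-≤ 3 k≤l)) PA-1
          b , b≢0 , PB⇔ , ¬PB = threshold (λ k → E (+ 1) (+ k)) xs (λ { refl → refl })
            (λ k → mk⇔ (λ PB-k → Equivalence.from (∈xs⇔ _) (ℰ̃-1-B k , height-≤⁺ (+ 1) (+ k) PA-1 PB-k))
                       (λ C∈ → proj₂ (height-≤⁻ (+ 1) (+ k) (proj₂ (Equivalence.to (∈xs⇔ _) C∈)))))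
            (λ {k} {l} k≤l → monomial-antitone {β} {X} 1≤β k l 2 2 (ℕ.^-monoˡ-≤ 2 k≤l)) PB-1
      in a , b , a≢0 , b≢0 ,
         (λ (E A B) → mk⇔
           (λ h → let x , y = height-≤⁻ A B h in Equivalence.to (PA⇔ _) x , Equivalence.to (PB⇔ _) y)
           (λ (A≤a , B≤b) → height-≤⁺ A B (Equivalence.from (PA⇔ _) A≤a) (Equivalence.from (PB⇔ _) B≤b))) ,
         ¬PA , ¬PB

cardinality-in-box : ∀ {ℱ : Pred Curve 0ℓ} (ℱ? : ∀ C → Dec (ℱ C)) {X h a b n} →
  (∀ C → h C ≤ X ⇔ InBox a b C) → HasCardinality (ℱ ⟨ X ⨾ h ⟩) n → n ≡ length (filter ℱ? (box a b))
cardinality-in-box ℱ? {a = a} {b} h⇔ (xs , xs-unique , ∈xs⇔ , refl) =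
  length-≡ xs-unique (Unique.filter⁺ ℱ? (box-unique a b))
    (λ {C} C∈ → let ℱC , h≤X = Equivalence.to (∈xs⇔ C) C∈ in
      ∈.∈-filter⁺ ℱ? (∈-box⁺ C (Equivalence.to (h⇔ C) h≤X)) ℱC)
    (λ {C} C∈ → let C∈box , ℱC = ∈.∈-filter⁻ ℱ? {xs = box a b} C∈ in
      Equivalence.from (∈xs⇔ C) (ℱC , Equivalence.from (h⇔ C) (∈-box⁻ a b C∈box)))

common-bound : ∀ α β → ∃[ K ] 1ℚ ℚ.≤ K × EventuallyBounded α K × EventuallyBounded β K
common-bound α β =
  let K , _ , M , α≤K = bounded α
      L , _ , N , β≤L = bounded β
  in 1ℚ ℚ.⊔ (K ℚ.⊔ L) , ℚ.p≤p⊔q 1ℚ (K ℚ.⊔ L) ,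
     (M , λ n M≤n → ℚ.≤-trans (ℚ.≤-trans (p≤∣p∣ (seq α n)) (α≤K n M≤n)) (ℚ.≤-trans (ℚ.p≤p⊔q K L) (ℚ.p≤q⊔p 1ℚ (K ℚ.⊔ L)))) ,
     (N , λ n N≤n → ℚ.≤-trans (ℚ.≤-trans (p≤∣p∣ (seq β n)) (β≤L n N≤n)) (ℚ.≤-trans (ℚ.p≤q⊔p K L) (ℚ.p≤q⊔p 1ℚ (K ℚ.⊔ L))))
  where
  p≤∣p∣ : ∀ p → p ℚ.≤ ℚ.∣ p ∣
  p≤∣p∣ p = [ (λ 0≤p → ℚ.≤-reflexive (sym (ℚ.0≤p⇒∣p∣≡p 0≤p))) , (λ p≤0 → ℚ.≤-trans p≤0 (ℚ.0≤∣p∣ p)) ]′ (ℚ.≤-total 0ℚ p)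

ζ₁₀⁻¹ : ℝ
ζ₁₀⁻¹ = reciprocal (ζ 10 (s≤s (s≤s z≤n))) (ζ-pos 10 (s≤s (s≤s z≤n)))

-- `reciprocal` cuts its argument off from below at the constant of `ζ-pos`, which is 1. Nonempty
-- partial sums are at least 1, so the cutoff changes nothing; the empty sum at index 0 is excluded.
ζ-partial*reciprocal : ∀ N → ζ-partial 10 (suc N) ℚ.* seq ζ₁₀⁻¹ (suc N) ≡ 1ℚ
ζ-partial*reciprocal N = trans
  (cong (ℚ._* seq ζ₁₀⁻¹ (suc N)) (sym (ℚ.p≥q⇒p⊔q≡p (ζ-partial-lower 10 N))))
  (*-recip (ζ-partial 10 (suc N) ℚ.⊔ 1/ℕ 1) (ℚ.<-≤-trans (0<1/ℕ 1) (ℚ.p≤q⊔p (ζ-partial 10 (suc N)) (1/ℕ 1))))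

ratio-error : ∀ {K r} a b .{{_ : ℕ.NonZero a}} .{{_ : ℕ.NonZero b}} .{{_ : ℕ.NonZero (#nonsingular a b)}} →
  fromℚ (1/ℕ (suc a)) ≤ fromℚ K * r → fromℚ (1/ℕ (suc b)) ≤ fromℚ K * r →
  ∣ fromℚ (+ #minimal a b ℚ./ #nonsingular a b) - ζ₁₀⁻¹ ∣ ≤ fromℚ (14ℚ ℚ.* K) * r
ratio-error {K} {r} a b p≤Kr q≤Kr ε 0<ε = suc (a ℕ.⊔ b) ℕ.⊔ (M ℕ.⊔ N) , λ k le →
  bound k (ℕ.m⊔n≤o⇒m≤o (suc (a ℕ.⊔ b)) (M ℕ.⊔ N) le)
    (proj₂ (p≤Kr δ 0<δ) k (ℕ.m⊔n≤o⇒m≤o M N (ℕ.m⊔n≤o⇒n≤o (suc (a ℕ.⊔ b)) (M ℕ.⊔ N) le)))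
    (proj₂ (q≤Kr δ 0<δ) k (ℕ.m⊔n≤o⇒n≤o M N (ℕ.m⊔n≤o⇒n≤o (suc (a ℕ.⊔ b)) (M ℕ.⊔ N) le)))
  where
  open ℚ.≤-Reasoning
  δ p q : ℚ
  δ = ε ℚ.* 1/ℕ 14
  p = 1/ℕ (suc a)
  q = 1/ℕ (suc b)
  0<δ : 0ℚ ℚ.< δ
  0<δ = *-pos 0<ε (0<1/ℕ 14)
  M N : ℕ
  M = proj₁ (p≤Kr δ 0<δ)
  N = proj₁ (q≤Kr δ 0<δ)
  bound : ∀ k → suc (a ℕ.⊔ b) ℕ.≤ k → p ℚ.≤ K ℚ.* seq r k ℚ.+ δ → q ℚ.≤ K ℚ.* seq r k ℚ.+ δ →
          ℚ.∣ (+ #minimal a b ℚ./ #nonsingular a b) ℚ.- seq ζ₁₀⁻¹ k ∣ ℚ.≤ 14ℚ ℚ.* K ℚ.* seq r k ℚ.+ ε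
  -- The term of `ζ₁₀⁻¹` at index `suc k` is the exact inverse of a partial sum admissible in
  -- `ratio-close`, so no tail of ζ(10) has to be estimated. Taking ε/14 in both hypotheses adds up
  -- to 7 · 2 · ε/14 = ε.
  bound (suc k) (s≤s a⊔b≤k) p≤ q≤ = begin
    ℚ.∣ (+ #minimal a b ℚ./ #nonsingular a b) ℚ.- seq ζ₁₀⁻¹ (suc k) ∣
      ≤⟨ ratio-close a b k (seq ζ₁₀⁻¹ (suc k)) (ℕ.m≤n⇒m≤1+n a⊔b≤k) (ζ-partial*reciprocal k) ⟩
    7ℚ ℚ.* (p ℚ.+ q)
      ≤⟨ ℚ.*-monoˡ-≤-nonNeg 7ℚ (ℚ.+-mono-≤ p≤ q≤) ⟩
    7ℚ ℚ.* ((K ℚ.* seq r (suc k) ℚ.+ ε ℚ.* 1/ℕ 14) ℚ.+ (K ℚ.* seq r (suc k) ℚ.+ ε ℚ.* 1/ℕ 14))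
      ≡⟨ solve 3 (λ K r ε → con 7ℚ :* ((K :* r :+ ε :* con (1/ℕ 14)) :+ (K :* r :+ ε :* con (1/ℕ 14))) := con 14ℚ :* K :* r :+ ε) refl K (seq r (suc k)) ε ⟩
    14ℚ ℚ.* K ℚ.* seq r (suc k) ℚ.+ ε ∎

theorem2p9 :
    (α β : ℝ) → 1ℝ ≤ α → 1ℝ ≤ β →
    ∃[ C ] ∃[ X₀ ] (∀ (X : ℝ) → 0ℝ < X → X₀ ≤ X →
      ∀ (n m : ℕ) →
      HasCardinality (ℰ ⟨ X ⨾ H α β ⟩) n →
      HasCardinality (ℰ̃ ⟨ X ⨾ H α β ⟩) m →
      Σ[ m≢0 ∈ ℕ.NonZero m ]
        (∀ (r : ℝ) → r Is X ^-⅓ →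
          ∣ fromℚ (ℚ._/_ (+ n) m {{m≢0}})
            - reciprocal (ζ 10 (s≤s (s≤s z≤n))) (ζ-pos 10 (s≤s (s≤s z≤n))) ∣
          ≤ C * r))
theorem2p9 α β 1≤α 1≤β =
  let K , 1≤K , α≤K , β≤K = common-bound α β in
  -- The constant 14K is 7 times the sum of two bounds K r, one for 1/(a + 1) and one for 1/(b + 1).
  -- The condition X ≥ K gives a, b ≥ 1 and thereby a nonzero denominator.
  fromℚ (14ℚ ℚ.* K) , fromℚ K , λ X _ K≤X n m card-ℰ card-ℰ̃ →
    let a , b , a≢0 , b≢0 , h⇔ , ¬PA , ¬PB = height-box {α} {β} {X} {K} 1≤α 1≤β α≤K β≤K K≤X card-ℰ̃
        n≡ = cardinality-in-box ℰ? {X} {H α β} {a} {b} h⇔ card-ℰ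
        m≡ = cardinality-in-box ℰ̃? {X} {H α β} {a} {b} h⇔ card-ℰ̃
    in transport {X} {fromℚ (14ℚ ℚ.* K)} (sym n≡) (sym m≡) (#nonsingular-nonZero a b {{a≢0}} {{b≢0}})
      λ r r³X≈1 → ratio-error {K} {r} a b {{a≢0}} {{b≢0}} {{#nonsingular-nonZero a b {{a≢0}} {{b≢0}}}}
        (reciprocal-root-bound {α} {X} {r} {K} a 1≤K α≤K r³X≈1 ¬PA)
        (reciprocal-root-bound {β} {X} {r} {K} b 1≤K β≤K r³X≈1
          -- As (b + 1)² ≤ (b + 1)³, failure of the square inequality entails failure of the cubic
          -- one. This gives up the true order X^(-1/2) of 1/b, which does not matter beside the
          -- X^(-1/3) coming from a.
          λ PB³ → ¬PB (monomial-antitone {β} {X} 1≤β (suc b) (suc b) 2 3 (ℕ.^-monoʳ-≤ (suc b) (ℕ.n≤1+n 2)) PB³))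
  where
  -- The fraction depends on the proof that its denominator is nonzero, so both counts are replaced
  -- at once, with the equations matched on variables.
  transport : ∀ {X C : ℝ} {n n′ m m′} → n ≡ n′ → m ≡ m′ → (m≢0 : ℕ.NonZero m) →
    (∀ r → r Is X ^-⅓ → ∣ fromℚ (ℚ._/_ (+ n) m {{m≢0}}) - ζ₁₀⁻¹ ∣ ≤ C * r) →
    Σ[ m≢0 ∈ ℕ.NonZero m′ ] (∀ r → r Is X ^-⅓ → ∣ fromℚ (ℚ._/_ (+ n′) m′ {{m≢0}}) - ζ₁₀⁻¹ ∣ ≤ C * r)
  transport refl refl m≢0 bound = m≢0 , bound
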